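{- There is an absolute constant $c>0$ such that for all sufficiently large $n$ the following holds. Let $Q_1,\dots,Q_n\colon\mathbb{F}_2^m\to\mathbb{F}_2$ be polynomials of degree at most $2$, and let $\mathcal{Q}$ be the distribution of $(Q_1(X),\dots,Q_n(X))$ for $X$ uniform on $\mathbb{F}_2^m$. Then \[ \|\mathcal{Q}-\mathrm{Ber}(1/3)^{\otimes n}\|_{\mathtt{TV}}\ \ge\ 1-n^{ -c/\log\log n}. \]
   Context: Logarithms are base 2. Total variation distance: $\|\mathcal{D}_1-\mathcal{D}_2\|_{\mathtt{TV}}=\frac12\sum_x|\mathcal{D}_1(x)-\mathcal{D}_2(x)|$; $\mathrm{Ber}(1/3)^{\otimes n}$ is the product of $n$ independent Bernoulli$(1/3)$ bits. -}

module Defs where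

open import Data.Bool using (Bool; true; false; _∧_; _xor_; if_then_else_)
import Data.Bool.Properties as Bool
open import Data.Fin using (Fin)
open import Data.Fin.Subset using (Subset)
import Data.Fin.Subset as Subset
open import Data.Integer using (ℤ; +_; -[1+_])
open import Data.List using (List; []; _∷_; _++_; map; foldr)
open import Data.Nat using (ℕ; zero; suc; NonZero)
import Data.Nat as ℕ
import Data.Nat.Properties as ℕ
open import Data.Product using (Σ-syntax; ∃-syntax; _×_)
open import Data.Rational using (ℚ; _/_; _+_; _*_; _-_; -_; _<_; _≤_; ∣_∣; ½; 0ℚ; 1ℚ; ↥_; ↧ₙ_; +-*-rawSemiring)
open import Data.Sum using (_⊎_)
open import Data.Vec using (Vec; []; _∷_; tabulate; zipWith)
import Data.Vec as Vec
import Data.Vec.Properties as Vec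
open import Relation.Binary.PropositionalEquality using (_≡_)
open import Relation.Nullary.Decidable using (⌊_⌋)
open import Algebra.Definitions.RawSemiring +-*-rawSemiring using (_^_)

-- The field with two elements: addition is _xor_, multiplication is _∧_.
𝔽₂ : Set
𝔽₂ = Bool

-- Every vector exactly once.
cube : ∀ m → List (Vec Bool m)
cube zero    = [] ∷ []
cube (suc m) = map (false ∷_) (cube m) ++ map (true ∷_) (cube m)

-- Polynomial functions over 𝔽₂.  Since b² = b in 𝔽₂, monomials are taken
-- squarefree, so a monomial is the set of variables occurring in it and a
-- polynomial is its family of coefficients.

Poly : ℕ → Set
Poly m = Subset m → 𝔽₂

monomial : ∀ {m} → Subset m → Vec 𝔽₂ m → 𝔽₂
monomial S x = Vec.foldr′ _∧_ true (zipWith (λ i∈S xᵢ → if i∈S then xᵢ else true) S x)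

eval : ∀ {m} → Poly m → Vec 𝔽₂ m → 𝔽₂
eval {m} p x = foldr _xor_ false (map (λ S → p S ∧ monomial S x) (cube m))

deg_≤_ : ∀ {m} → Poly m → ℕ → Set
deg p ≤ d = ∀ S → p S ≡ true → Subset.∣ S ∣ ℕ.≤ d

IsPolynomialOfDegree≤ : ∀ {m} → ℕ → (Vec 𝔽₂ m → 𝔽₂) → Set
IsPolynomialOfDegree≤ {m} d f = Σ[ p ∈ Poly m ] (deg p ≤ d × (∀ x → f x ≡ eval p x))

-- Probability mass functions on {0,1}ⁿ.

Distribution : ℕ → Set
Distribution n = Vec Bool n → ℚ

Σ[_] : ∀ n → (Vec Bool n → ℚ) → ℚ
Σ[ n ] f = foldr _+_ 0ℚ (map f (cube n))

uniform : ∀ m → Distribution m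
uniform m _ = ½ ^ m

pushforward : ∀ {m n} → (Vec Bool m → Vec Bool n) → Distribution m → Distribution n
pushforward {m} f D y = Σ[ m ] λ x → if ⌊ Vec.≡-dec Bool._≟_ (f x) y ⌋ then D x else 0ℚ

outputDistribution : ∀ {m n} → (Fin n → Vec 𝔽₂ m → 𝔽₂) → Distribution n
outputDistribution {m} Q = pushforward (λ x → tabulate (λ i → Q i x)) (uniform m)

Ber : ℚ → Bool → ℚ
Ber p b = if b then p else 1ℚ - p

_^⊗_ : (Bool → ℚ) → ∀ n → Distribution n
(D ^⊗ n) y = Vec.foldr′ _*_ 1ℚ (Vec.map D y)

TV : ∀ {n} → Distribution n → Distribution n → ℚ
TV {n} D₁ D₂ = ½ * Σ[ n ] λ x → ∣ D₁ x - D₂ x ∣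

-- A real number x is represented by its Dedekind cut: lower x is to be
-- { q ∈ ℚ ∣ q < x } and upper x is to be { q ∈ ℚ ∣ x < q }.  The cut axioms are
-- not carried along; every operation below returns the cut of its value
-- whenever its arguments are cuts of reals in the stated range.
record ℝ : Set₁ where
  field
    lower upper : ℚ → Set
open ℝ public

fromℚ : ℚ → ℝ
fromℚ p .lower q = q < p
fromℚ p .upper q = p < q

fromℕ : ℕ → ℝ
fromℕ n = fromℚ (+ n / 1)

infix  4 _≤ᴿ_
infixl 6 _+ᴿ_ _-ᴿ_
infix  8 -ᴿ_
infixl 7 _÷ᴿ_
infixr 8 _^ᴿ_ _^ᶻ_

_≤ᴿ_ : ℝ → ℝ → Set
x ≤ᴿ y = ∀ q → lower x q → lower y q

_+ᴿ_ : ℝ → ℝ → ℝ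
(x +ᴿ y) .lower q = ∃[ a ] ∃[ b ] (lower x a × lower y b × q ≡ a + b)
(x +ᴿ y) .upper q = ∃[ a ] ∃[ b ] (upper x a × upper y b × q ≡ a + b)

-ᴿ_ : ℝ → ℝ
(-ᴿ x) .lower q = upper x (- q)
(-ᴿ x) .upper q = lower x (- q)

_-ᴿ_ : ℝ → ℝ → ℝ
x -ᴿ y = x +ᴿ (-ᴿ y)

-- For x > 0 and y > 0.
_÷ᴿ_ : ℝ → ℝ → ℝ
(x ÷ᴿ y) .lower q = ∃[ a ] ∃[ b ] (lower x a × upper y b × 0ℚ < b × q * b < a)
(x ÷ᴿ y) .upper q = ∃[ a ] ∃[ b ] (upper x a × lower y b × 0ℚ < b × a < q * b)

_^ᶻ_ : (b : ℕ) .{{_ : NonZero b}} → ℤ → ℚ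
b ^ᶻ (+ k)    = + (b ℕ.^ k) / 1
b ^ᶻ -[1+ k ] = (+ 1 / (b ℕ.^ suc k)) {{ℕ.m^n≢0 b (suc k)}}

-- q < bʳ and bʳ < q for rational r = s / t with t > 0, decided by comparing
-- qᵗ with bˢ (where bʳ > 0).
_<_^ℚ_ : ℚ → (b : ℕ) .{{_ : NonZero b}} → ℚ → Set
q < b ^ℚ r = q ≤ 0ℚ ⊎ q ^ (↧ₙ r) < b ^ᶻ (↥ r)

_^ℚ_<_ : (b : ℕ) .{{_ : NonZero b}} → ℚ → ℚ → Set
b ^ℚ r < q = 0ℚ < q × b ^ᶻ (↥ r) < q ^ (↧ₙ r)

-- For an integer b ≥ 1, so that r ↦ bʳ is monotone.
_^ᴿ_ : (b : ℕ) .{{_ : NonZero b}} → ℝ → ℝ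
(b ^ᴿ x) .lower q = ∃[ r ] (lower x r × q < b ^ℚ r)
(b ^ᴿ x) .upper q = ∃[ r ] (upper x r × b ^ℚ r < q)

-- The base 2 logarithm, for x > 0.
log : ℝ → ℝ
log x .lower q = ∃[ r ] (lower x r × 2 ^ℚ q < r)
log x .upper q = ∃[ r ] (upper x r × r < 2 ^ℚ q)

{-# OPTIONS --safe #-}
-- On a coset of a subgroup H of 𝔽₂ᵐ, the sum S of (-1)^f for a quadratic f
-- satisfies S = 0 or S² = |H||A| with A ≤ H, so f is 1 with probability at least
-- 3/8 or at most 13/40, bounded away from 1/3. Hence p functions that are
-- independent on every coset of H are distinguished from Ber(1/3)^p with error
-- [𝔽₂ᵐ : H] β^p for some β < 1, by a union bound over the cosets.
--
-- Let t be a large multiple of log(1/ε). Either t of the Qᵢ have no combination of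
-- bias 2^-t, and then they are jointly close to uniform; or, after a union bound
-- over the values of fewer than t of them, all Qᵢ have bias at least 2^-t, which
-- makes each invariant under a subgroup of index at most 2^(2t). In the second
-- case take H to be the common stabiliser of a set F, initially empty, and collect
-- greedily functions that are independent on the cosets of H. If they remain too
-- few for the union bound, adding them to F halves the index in H of the
-- invariance subgroup of every Qᵢ, which happens at most 2t times. Every round
-- multiplies the size of F by O(t), so t^O(t) ≤ n functions suffice, which allows
-- log(1/ε) of order log n / log log n.
module Submission where

open import Defs
open import Algebra.Bundles using (CommutativeRing)
open import Data.Bool using (Bool; true; false; not; _∧_; _∨_; _xor_; if_then_else_)
import Data.Bool.Properties as Bool
open import Data.Fin using (Fin)
open import Data.Fin.Subset using (Subset)
import Data.Fin.Subset as Subset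
open import Data.Integer using (+_; -[1+_])
import Data.Integer as ℤ
import Data.Integer.Properties as ℤ
open import Data.List using (List; []; _∷_; _++_; map; foldr; length)
import Data.List.Properties as List
import Data.List.Relation.Unary.All as ListAll
open import Data.Nat using (ℕ; zero; suc; z≤n; s≤s; NonZero; _≤_)
import Data.Nat as ℕ
import Data.Nat.DivMod as ℕ
import Data.Nat.Properties as ℕ
open import Data.Nat.Tactic.RingSolver using (solve-∀)
open import Data.Product using (∃; ∃-syntax; _×_; _,_; proj₁; proj₂)
open import Data.Rational using (ℚ; mkℚ; _/_; _+_; _*_; _-_; -_; _<_; ∣_∣; ½; 0ℚ; 1ℚ; ↥_; ↧ₙ_; toℚᵘ; nonNegative; positive; +-*-rawSemiring) renaming (_≤_ to _≤ℚ_)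
import Data.Rational.Properties as ℚ
open import Data.Rational.Solver using (module +-*-Solver)
open import Data.Rational.Unnormalised using (mkℚᵘ; *<*; *≤*; *≡*)
import Data.Rational.Unnormalised as ℚᵘ
import Data.Rational.Unnormalised.Properties as ℚᵘ
open import Data.Sum using (_⊎_; inj₁; inj₂; [_,_]′)
open import Data.Unit using (⊤; tt)
open import Data.Vec using (Vec; []; _∷_; head; tail; zipWith; replicate; tabulate)
import Data.Vec as Vec
import Data.Vec.Properties as Vec
open import Data.Vec.Relation.Unary.All using (All; []; _∷_)
import Data.Vec.Relation.Unary.All as All
import Data.Vec.Relation.Unary.All.Properties as All
open import Function using (_∘_; const)
open import Relation.Binary.PropositionalEquality
open import Relation.Nullary using (¬_; Dec; yes; no; does; contradiction)
open import Relation.Nullary.Decidable using (⌊_⌋)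
open import Algebra.Definitions.RawSemiring +-*-rawSemiring using (_^_)
open import Algebra.Properties.Semiring.Exp (CommutativeRing.semiring ℚ.+-*-commutativeRing) using (^-homo-*; ^-assocʳ)
open import Algebra.Properties.CommutativeSemiring.Exp (CommutativeRing.commutativeSemiring ℚ.+-*-commutativeRing) using (^-distrib-*)
open +-*-Solver using (solve; con; _:=_; _:+_; _:*_; _:-_; :-_)

-- The sign sum S of f on a coset of H is |H| times the difference of the probabilities of 0 and 1,
-- so probability 1/3 would need S = |H|/3. As the index of A in H is a power of two, S/|H| is 0 or
-- ±2^(-j/2); the possible values on either side of 1/3 are 1/4 and 2^(-3/2) > 7/20, which give 3/8
-- and 13/40.
--
-- The side on which f falls varies with the coset, so no single likelihood test serves all cosets:
-- the tests of all of them are tried, at the price of a factor [𝔽₂ᵐ : H]. The independent family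
-- must therefore outgrow the logarithm of this index, which is linear in the size of F. This is
-- what forces a factor O(t) per round.
--
-- The halving comes from counting. If f is not independent of a chain on the cosets of H, let A be
-- the stabiliser of the chain in H and B the invariance subgroup of f in H. Then A + B is a proper
-- subgroup of H, so [A : A ∩ B] = [A + B : B] is at most half of [H : B]. All facts on subgroups
-- are obtained by counting pairs, without bases or normal forms of quadratic forms.

-- Order and arithmetic of ℚ

≤-by : ∀ {p q} d → 0ℚ ≤ℚ d → p + d ≡ q → p ≤ℚ q
≤-by {p} d 0≤d refl = subst (_≤ℚ p + d) (ℚ.+-identityʳ p) (ℚ.+-monoʳ-≤ p 0≤d)

0≤q-p : ∀ {p q} → p ≤ℚ q → 0ℚ ≤ℚ q - p
0≤q-p {p} {q} p≤q = subst (_≤ℚ q - p) (ℚ.+-inverseʳ p) (ℚ.+-monoˡ-≤ (- p) p≤q)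

0≤-+ : ∀ {p q} → 0ℚ ≤ℚ p → 0ℚ ≤ℚ q → 0ℚ ≤ℚ p + q
0≤-+ = ℚ.+-mono-≤

*-monoʳ : ∀ {p q} r → 0ℚ ≤ℚ r → p ≤ℚ q → p * r ≤ℚ q * r
*-monoʳ r 0≤r = ℚ.*-monoʳ-≤-nonNeg r {{nonNegative 0≤r}}

*-monoˡ : ∀ {p q} r → 0ℚ ≤ℚ r → p ≤ℚ q → r * p ≤ℚ r * q
*-monoˡ r 0≤r = ℚ.*-monoˡ-≤-nonNeg r {{nonNegative 0≤r}}

0≤-* : ∀ {p q} → 0ℚ ≤ℚ p → 0ℚ ≤ℚ q → 0ℚ ≤ℚ p * q
0≤-* {p} {q} 0≤p 0≤q = subst (_≤ℚ p * q) (ℚ.*-zeroˡ q) (*-monoʳ q 0≤q 0≤p)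

0<-* : ∀ {p q} → 0ℚ < p → 0ℚ < q → 0ℚ < p * q
0<-* {p} {q} 0<p 0<q =
  subst (_< p * q) (ℚ.*-zeroˡ q) (ℚ.*-monoˡ-<-pos q {{positive 0<q}} 0<p)

*-mono : ∀ {p q r s} → 0ℚ ≤ℚ r → 0ℚ ≤ℚ q → p ≤ℚ q → r ≤ℚ s → p * r ≤ℚ q * s
*-mono {p} {q} {r} {s} 0≤r 0≤q p≤q r≤s = ℚ.≤-trans (*-monoʳ r 0≤r p≤q) (*-monoˡ q 0≤q r≤s)

*-cancelʳ : ∀ {p q} r → 0ℚ < r → p * r ≤ℚ q * r → p ≤ℚ q
*-cancelʳ r 0<r = ℚ.*-cancelʳ-≤-pos r {{positive 0<r}}

0≤½ : 0ℚ ≤ℚ ½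
0≤½ = ℚ.≤ᵇ⇒≤ _

0≤1 : 0ℚ ≤ℚ 1ℚ
0≤1 = ℚ.≤ᵇ⇒≤ _

0≤^ : ∀ {p} → 0ℚ ≤ℚ p → ∀ n → 0ℚ ≤ℚ p ^ n
0≤^ 0≤p zero = 0≤1
0≤^ 0≤p (suc n) = 0≤-* 0≤p (0≤^ 0≤p n)

⟦_⟧ : Bool → ℚ
⟦ b ⟧ = if b then 1ℚ else 0ℚ

0≤⟦_⟧ : ∀ b → 0ℚ ≤ℚ ⟦ b ⟧
0≤⟦ true ⟧ = 0≤1
0≤⟦ false ⟧ = ℚ.≤-refl

⟦⟧≤1 : ∀ b → ⟦ b ⟧ ≤ℚ 1ℚ
⟦⟧≤1 true = ℚ.≤-refl
⟦⟧≤1 false = 0≤1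

⟦∧⟧ : ∀ a b → ⟦ a ∧ b ⟧ ≡ ⟦ a ⟧ * ⟦ b ⟧
⟦∧⟧ true b = sym (ℚ.*-identityˡ ⟦ b ⟧)
⟦∧⟧ false b = sym (ℚ.*-zeroˡ ⟦ b ⟧)

sgn : Bool → ℚ
sgn b = if b then - 1ℚ else 1ℚ

sgn-xor : ∀ a b → sgn (a xor b) ≡ sgn a * sgn b
sgn-xor false b = sym (ℚ.*-identityˡ (sgn b))
sgn-xor true false = refl
sgn-xor true true = refl

-- Sums over the cube

-- Opaque, so that unification recovers m from the summand.
opaque

  ∑ : ∀ {m} → (Vec Bool m → ℚ) → ℚ
  ∑ {m} = Σ[ m ]

  ∑-def : ∀ {m} (f : Vec Bool m → ℚ) → ∑ f ≡ Σ[ m ] f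
  ∑-def f = refl

  ∑-zero : (f : Vec Bool zero → ℚ) → ∑ f ≡ f []
  ∑-zero f = ℚ.+-identityʳ (f [])

  ∑-suc : ∀ m (f : Vec Bool (suc m) → ℚ) →
          ∑ f ≡ ∑ (f ∘ (false ∷_)) + ∑ (f ∘ (true ∷_))
  ∑-suc m f = trans (cong (foldr _+_ 0ℚ) (List.map-++ f (map (false ∷_) (cube m)) _))
    (trans (foldr-++ (map f (map (false ∷_) (cube m))) _)
           (cong₂ _+_ (half false) (half true)))
    where
    foldr-++ : ∀ xs ys → foldr _+_ 0ℚ (xs ++ ys) ≡ foldr _+_ 0ℚ xs + foldr _+_ 0ℚ ys
    foldr-++ [] ys = sym (ℚ.+-identityˡ _)
    foldr-++ (x ∷ xs) ys = trans (cong (λ z → x + z) (foldr-++ xs ys)) (sym (ℚ.+-assoc x _ _))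
    half : ∀ b → foldr _+_ 0ℚ (map f (map (b ∷_) (cube m))) ≡ ∑ (f ∘ (b ∷_))
    half b = cong (foldr _+_ 0ℚ) (sym (List.map-∘ (cube m)))

  ∑-cong : ∀ {m} {f g : Vec Bool m → ℚ} → (∀ x → f x ≡ g x) → ∑ f ≡ ∑ g
  ∑-cong {m} f≗g = cong (foldr _+_ 0ℚ) (List.map-cong f≗g (cube m))

  ∑-mono : ∀ {m} {f g : Vec Bool m → ℚ} → (∀ x → f x ≤ℚ g x) → ∑ f ≤ℚ ∑ g
  ∑-mono {m} {f} {g} f≤g = go (cube m)
    where
    go : ∀ xs → foldr _+_ 0ℚ (map f xs) ≤ℚ foldr _+_ 0ℚ (map g xs)
    go [] = ℚ.≤-refl
    go (x ∷ xs) = ℚ.+-mono-≤ (f≤g x) (go xs)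

  ∑-+ : ∀ {m} (f g : Vec Bool m → ℚ) → ∑ (λ x → f x + g x) ≡ ∑ f + ∑ g
  ∑-+ {m} f g = go (cube m)
    where
    go : ∀ xs → foldr _+_ 0ℚ (map (λ x → f x + g x) xs)
              ≡ foldr _+_ 0ℚ (map f xs) + foldr _+_ 0ℚ (map g xs)
    go [] = refl
    go (x ∷ xs) = trans (cong (λ z → f x + g x + z) (go xs))
      (solve 4 (λ a b c d → a :+ b :+ (c :+ d) := a :+ c :+ (b :+ d)) refl (f x) (g x) _ _)

  ∑-*ˡ : ∀ {m} c (f : Vec Bool m → ℚ) → ∑ (λ x → c * f x) ≡ c * ∑ f
  ∑-*ˡ {m} c f = go (cube m)
    where
    go : ∀ xs → foldr _+_ 0ℚ (map (λ x → c * f x) xs) ≡ c * foldr _+_ 0ℚ (map f xs)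
    go [] = sym (ℚ.*-zeroʳ c)
    go (x ∷ xs) = trans (cong (λ z → c * f x + z) (go xs)) (sym (ℚ.*-distribˡ-+ c _ _))

  ∑-*ʳ : ∀ {m} c (f : Vec Bool m → ℚ) → ∑ (λ x → f x * c) ≡ ∑ f * c
  ∑-*ʳ c f = trans (∑-cong (λ x → ℚ.*-comm (f x) c)) (trans (∑-*ˡ c f) (ℚ.*-comm c _))

  ∑-0 : ∀ m → ∑ {m} (λ _ → 0ℚ) ≡ 0ℚ
  ∑-0 m = trans (∑-*ˡ {m} 0ℚ (λ _ → 0ℚ)) (ℚ.*-zeroˡ (∑ {m} (λ _ → 0ℚ)))

  ∑-≥0 : ∀ {m} {f : Vec Bool m → ℚ} → (∀ x → 0ℚ ≤ℚ f x) → 0ℚ ≤ℚ ∑ f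
  ∑-≥0 {m} {f} 0≤f = subst (_≤ℚ ∑ f) (∑-0 m) (∑-mono 0≤f)

  ∑-swap : ∀ {m n} (f : Vec Bool m → Vec Bool n → ℚ) →
           ∑ (λ x → ∑ (f x)) ≡ ∑ (λ y → ∑ (λ x → f x y))
  ∑-swap {m} {n} f = go (cube m)
    where
    go : ∀ xs → foldr _+_ 0ℚ (map (λ x → ∑ (f x)) xs)
              ≡ ∑ (λ y → foldr _+_ 0ℚ (map (λ x → f x y) xs))
    go [] = sym (∑-0 n)
    go (x ∷ xs) = trans (cong (λ z → ∑ (f x) + z) (go xs)) (sym (∑-+ (f x) _))

  ∑-single : ∀ {m} (f : Vec Bool m → ℚ) z → (∀ x → x ≢ z → f x ≡ 0ℚ) → ∑ f ≡ f z
  ∑-single f [] _ = ℚ.+-identityʳ _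
  ∑-single {suc m} f (b ∷ z) off = trans (∑-suc m f) (halves b off)
    where
    same : ∀ b → (∀ x → x ≢ b ∷ z → f x ≡ 0ℚ) → ∑ (f ∘ (b ∷_)) ≡ f (b ∷ z)
    same b off = ∑-single _ z (λ x x≢z → off (b ∷ x) (x≢z ∘ Vec.∷-injectiveʳ))
    other : ∀ b c → b ≢ c → (∀ x → x ≢ b ∷ z → f x ≡ 0ℚ) → ∑ (f ∘ (c ∷_)) ≡ 0ℚ
    other b c b≢c off =
      trans (∑-cong (λ x → off (c ∷ x) (b≢c ∘ sym ∘ Vec.∷-injectiveˡ))) (∑-0 m)
    halves : ∀ b → (∀ x → x ≢ b ∷ z → f x ≡ 0ℚ) →
             ∑ (f ∘ (false ∷_)) + ∑ (f ∘ (true ∷_)) ≡ f (b ∷ z)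
    halves false off = trans (cong₂ _+_ (same false off) (other false true (λ ()) off)) (ℚ.+-identityʳ _)
    halves true off = trans (cong₂ _+_ (other true false (λ ()) off) (same true off)) (ℚ.+-identityˡ _)

  term≤∑ : ∀ {m} {f : Vec Bool m → ℚ} → (∀ x → 0ℚ ≤ℚ f x) → ∀ z → f z ≤ℚ ∑ f
  term≤∑ {f = f} 0≤f [] = ℚ.≤-reflexive (sym (ℚ.+-identityʳ _))
  term≤∑ {suc m} {f} 0≤f (false ∷ z) = ℚ.≤-trans (term≤∑ (λ x → 0≤f (false ∷ x)) z)
    (≤-by _ (∑-≥0 (λ x → 0≤f (true ∷ x))) (sym (∑-suc m f)))
  term≤∑ {suc m} {f} 0≤f (true ∷ z) = ℚ.≤-trans (term≤∑ (λ x → 0≤f (true ∷ x)) z)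
    (≤-by _ (∑-≥0 (λ x → 0≤f (false ∷ x))) (trans (ℚ.+-comm _ (∑ (f ∘ (false ∷_)))) (sym (∑-suc m f))))

∣𝔽₂^_∣ : ℕ → ℚ
∣𝔽₂^ m ∣ = ∑ {m} (λ _ → 1ℚ)

½^-*-∣𝔽₂^∣ : ∀ m → ½ ^ m * ∣𝔽₂^ m ∣ ≡ 1ℚ
½^-*-∣𝔽₂^∣ zero = trans (ℚ.*-identityˡ _) (∑-zero (λ _ → 1ℚ))
½^-*-∣𝔽₂^∣ (suc m) = trans (cong (½ * ½ ^ m *_) (∑-suc m (λ _ → 1ℚ)))
  (trans (solve 2 (λ h N → con ½ :* h :* (N :+ N) := h :* N) refl (½ ^ m) ∣𝔽₂^ m ∣)
         (½^-*-∣𝔽₂^∣ m))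

∑-const : ∀ m c → ∑ {m} (λ _ → c) ≡ ∣𝔽₂^ m ∣ * c
∑-const m c = trans (∑-cong {m} (λ _ → sym (ℚ.*-identityˡ c))) (∑-*ʳ {m} c (λ _ → 1ℚ))

0<∣𝔽₂^_∣ : ∀ m → 0ℚ < ∣𝔽₂^ m ∣
0<∣𝔽₂^ m ∣ = ℚ.<-≤-trans (ℚ.positive⁻¹ 1ℚ) (term≤∑ {m} (λ _ → 0≤1) (replicate m false))

infixl 6 _⊕_
_⊕_ : ∀ {m} → Vec Bool m → Vec Bool m → Vec Bool m
_⊕_ = zipWith _xor_

𝟎 : ∀ {m} → Vec Bool m
𝟎 = replicate _ false

⊕-comm : ∀ {m} (x y : Vec Bool m) → x ⊕ y ≡ y ⊕ x
⊕-comm = Vec.zipWith-comm Bool.xor-comm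

⊕-assoc : ∀ {m} (x y z : Vec Bool m) → x ⊕ y ⊕ z ≡ x ⊕ (y ⊕ z)
⊕-assoc = Vec.zipWith-assoc Bool.xor-assoc

⊕-identityʳ : ∀ {m} (x : Vec Bool m) → x ⊕ 𝟎 ≡ x
⊕-identityʳ = Vec.zipWith-identityʳ Bool.xor-identityʳ

⊕-identityˡ : ∀ {m} (x : Vec Bool m) → 𝟎 ⊕ x ≡ x
⊕-identityˡ = Vec.zipWith-identityˡ Bool.xor-identityˡ

⊕-self : ∀ {m} (x : Vec Bool m) → x ⊕ x ≡ 𝟎
⊕-self [] = refl
⊕-self (b ∷ x) = cong₂ _∷_ (Bool.xor-same b) (⊕-self x)

⊕-cancelʳ : ∀ {m} (x y : Vec Bool m) → x ⊕ y ⊕ y ≡ x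
⊕-cancelʳ x y = trans (⊕-assoc x y y) (trans (cong (x ⊕_) (⊕-self y)) (⊕-identityʳ x))

⊕-cancelˡ : ∀ {m} (x y : Vec Bool m) → x ⊕ (x ⊕ y) ≡ y
⊕-cancelˡ x y = trans (sym (⊕-assoc x x y)) (trans (cong (_⊕ y) (⊕-self x)) (⊕-identityˡ y))

⊕-swapʳ : ∀ {m} (x y z : Vec Bool m) → x ⊕ y ⊕ z ≡ x ⊕ z ⊕ y
⊕-swapʳ x y z = trans (⊕-assoc x y z) (trans (cong (x ⊕_) (⊕-comm y z)) (sym (⊕-assoc x z y)))

∑-translate : ∀ {m} (f : Vec Bool m → ℚ) a → ∑ (λ x → f (x ⊕ a)) ≡ ∑ f
∑-translate f [] = trans (∑-zero _) (sym (∑-zero f))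
∑-translate {suc m} f (false ∷ a) = trans (∑-suc m _)
  (trans (cong₂ _+_ (∑-translate (f ∘ (false ∷_)) a) (∑-translate (f ∘ (true ∷_)) a))
         (sym (∑-suc m f)))
∑-translate {suc m} f (true ∷ a) = trans (∑-suc m _)
  (trans (cong₂ _+_ (∑-translate (f ∘ (true ∷_)) a) (∑-translate (f ∘ (false ∷_)) a))
         (trans (ℚ.+-comm _ (∑ (f ∘ (false ∷_)))) (sym (∑-suc m f))))

-- The source of decidability: it keeps the case distinctions on vectors constructive.
search : ∀ {m} (p : Vec Bool m → Bool) → (∃[ x ] p x ≡ true) ⊎ (∀ x → p x ≡ false)
search {zero} p with p [] in eq
... | true = inj₁ ([] , eq)
... | false = inj₂ λ { [] → eq }
search {suc m} p with search (p ∘ (false ∷_)) | search (p ∘ (true ∷_))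
... | inj₁ (x , px) | _ = inj₁ (false ∷ x , px)
... | inj₂ _ | inj₁ (x , px) = inj₁ (true ∷ x , px)
... | inj₂ ¬f | inj₂ ¬t = inj₂ λ { (false ∷ x) → ¬f x ; (true ∷ x) → ¬t x }

-- Counting in subgroups of 𝔽₂ᵐ

2ℚ : ℚ
2ℚ = 1ℚ + 1ℚ

0≤2 : 0ℚ ≤ℚ 2ℚ
0≤2 = ℚ.≤ᵇ⇒≤ _

∧-true⁻ : ∀ a {b} → a ∧ b ≡ true → a ≡ true × b ≡ true
∧-true⁻ true eq = refl , eq

∧-true⁺ : ∀ {a b} → a ≡ true → b ≡ true → a ∧ b ≡ true
∧-true⁺ refl eq = eq

¬true⇒false : ∀ b → ¬ (b ≡ true) → b ≡ false
¬true⇒false b = Bool.¬-not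

⟦⟧-mono : ∀ {a b} → (a ≡ true → b ≡ true) → ⟦ a ⟧ ≤ℚ ⟦ b ⟧
⟦⟧-mono {false} {b} _ = 0≤⟦ b ⟧
⟦⟧-mono {true} imp rewrite imp refl = ℚ.≤-refl

≤2^* : ∀ r {c} → 0ℚ ≤ℚ c → c ≤ℚ 2ℚ ^ r * c
≤2^* zero {c} 0≤c = ℚ.≤-reflexive (sym (ℚ.*-identityˡ c))
≤2^* (suc r) {c} 0≤c = ℚ.≤-trans (≤2^* r 0≤c) (≤-by (2ℚ ^ r * c) (0≤-* (0≤^ 0≤2 r) 0≤c)
  (solve 2 (λ a k → a :* k :+ a :* k := con 2ℚ :* a :* k) refl (2ℚ ^ r) c))

module _ {m : ℕ} where

  Pred : Set
  Pred = Vec Bool m → Bool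

  infix 4 _∈_ _⊆_
  _∈_ : Vec Bool m → Pred → Set
  x ∈ p = p x ≡ true

  _⊆_ : Pred → Pred → Set
  p ⊆ q = ∀ {x} → x ∈ p → x ∈ q

  infixr 7 _∩_
  _∩_ : Pred → Pred → Pred
  (p ∩ q) x = p x ∧ q x

  card : Pred → ℚ
  card p = ∑ (λ x → ⟦ p x ⟧)

  card≥0 : ∀ p → 0ℚ ≤ℚ card p
  card≥0 p = ∑-≥0 (λ x → 0≤⟦ p x ⟧)

  card-mono : ∀ {p q} → p ⊆ q → card p ≤ℚ card q
  card-mono {p} {q} p⊆q = ∑-mono (λ x → ⟦⟧-mono (p⊆q {x}))

  card-empty : ∀ {p} → (∀ x → p x ≡ false) → card p ≡ 0ℚ
  card-empty empty = trans (∑-cong (λ x → cong ⟦_⟧ (empty x))) (∑-0 m)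

  -- Every vector is its own inverse, so these are exactly the linear subspaces.
  record IsSubgroup (p : Pred) : Set where
    field
      𝟎∈     : 𝟎 ∈ p
      closed : ∀ {x y} → x ∈ p → y ∈ p → (x ⊕ y) ∈ p

    shift : ∀ {a} → a ∈ p → ∀ x → p (x ⊕ a) ≡ p x
    shift {a} a∈p x with p x in x? | p (x ⊕ a) in xa?
    ... | true | true = refl
    ... | false | false = refl
    ... | true | false = trans (sym xa?) (closed x? a∈p)
    ... | false | true = trans (sym (closed xa? a∈p)) (trans (cong p (⊕-cancelʳ x a)) x?)

    0<card : 0ℚ < card p
    0<card = ℚ.<-≤-trans (ℚ.positive⁻¹ 1ℚ)
      (subst (λ b → ⟦ b ⟧ ≤ℚ card p) 𝟎∈ (term≤∑ (λ x → 0≤⟦ p x ⟧) 𝟎))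

  open IsSubgroup

  ∩-isSubgroup : ∀ {p q} → IsSubgroup p → IsSubgroup q → IsSubgroup (p ∩ q)
  ∩-isSubgroup P Q .𝟎∈ = ∧-true⁺ (𝟎∈ P) (𝟎∈ Q)
  ∩-isSubgroup {p} P Q .closed {x} {y} x∈ y∈ =
    let x∈p , x∈q = ∧-true⁻ (p x) x∈ ; y∈p , y∈q = ∧-true⁻ (p y) y∈
    in ∧-true⁺ (closed P x∈p y∈p) (closed Q x∈q y∈q)

  -- The number of ways of writing z as a sum of elements of A and B.
  sums : Pred → Pred → Vec Bool m → ℚ
  sums A B z = card (λ a → A a ∧ B (z ⊕ a))

  module _ {A B : Pred} (SA : IsSubgroup A) (SB : IsSubgroup B) where

    -- Two representations of z differ by an element of A ∩ B, so there are either none or exactly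
    -- |A ∩ B| of them.
    sums≤ : ∀ z → sums A B z ≤ℚ card (A ∩ B)
    sums≤ z with search (λ a → A a ∧ B (z ⊕ a))
    ... | inj₂ none = subst (_≤ℚ card (A ∩ B)) (sym (card-empty none)) (card≥0 (A ∩ B))
    ... | inj₁ (a₀ , both) = ℚ.≤-reflexive (trans (sym (∑-translate _ a₀)) (∑-cong same))
      where
      a₀∈A = proj₁ (∧-true⁻ (A a₀) both)
      za₀∈B = proj₂ (∧-true⁻ (A a₀) both)
      same : ∀ x → ⟦ A (x ⊕ a₀) ∧ B (z ⊕ (x ⊕ a₀)) ⟧ ≡ ⟦ A x ∧ B x ⟧
      same x = cong ⟦_⟧ (cong₂ _∧_ (shift SA a₀∈A x)
        (trans (cong B (trans (sym (⊕-assoc z x a₀)) (trans (cong (_⊕ a₀) (⊕-comm z x)) (⊕-assoc x z a₀))))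
               (shift SB za₀∈B x)))

    ∑-sums : ∑ (sums A B) ≡ card A * card B
    ∑-sums = trans (∑-swap _) (trans (∑-cong inner) (∑-*ʳ (card B) (λ a → ⟦ A a ⟧)))
      where
      inner : ∀ a → ∑ (λ z → ⟦ A a ∧ B (z ⊕ a) ⟧) ≡ ⟦ A a ⟧ * card B
      inner a = trans (∑-cong (λ z → ⟦∧⟧ (A a) (B (z ⊕ a))))
        (trans (∑-*ˡ ⟦ A a ⟧ _) (cong (⟦ A a ⟧ *_) (∑-translate (λ z → ⟦ B z ⟧) a)))

    module _ {H : Pred} (SH : IsSubgroup H) (A⊆H : A ⊆ H) (B⊆H : B ⊆ H) where

      sums-on-H : ∀ z → sums A B z ≡ ⟦ H z ⟧ * sums A B z
      sums-on-H z with H z in z?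
      ... | true = sym (ℚ.*-identityˡ (sums A B z))
      ... | false = trans (card-empty (λ a → ¬true⇒false _ (outside a))) (sym (ℚ.*-zeroˡ (sums A B z)))
        where
        outside : ∀ a → ¬ (A a ∧ B (z ⊕ a) ≡ true)
        outside a both =
          let a∈A , za∈B = ∧-true⁻ (A a) both
          in contradiction (trans (sym z?) (trans (sym (shift SH (A⊆H a∈A) z)) (B⊆H za∈B))) (λ ())

      -- The |A||B| sums a + b all lie in H, and each value is taken at most |A ∩ B| times.
      card-∩ : card A * card B ≤ℚ card H * card (A ∩ B)
      card-∩ = subst₂ _≤ℚ_ (trans (sym (∑-cong sums-on-H)) ∑-sums) (∑-*ʳ (card (A ∩ B)) (λ z → ⟦ H z ⟧))
        (∑-mono (λ z → *-monoˡ ⟦ H z ⟧ 0≤⟦ H z ⟧ (sums≤ z)))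

      -- A + B and h + A + B are disjoint.
      card-∩-uncovered : ∀ {h} → h ∈ H → (∀ {a} → a ∈ A → B (h ⊕ a) ≡ false) →
                         2ℚ * (card A * card B) ≤ℚ card H * card (A ∩ B)
      card-∩-uncovered {h} h∈H uncovered = begin
        2ℚ * (card A * card B)
          ≡⟨ cong (2ℚ *_) (sym ∑-sums) ⟩
        2ℚ * ∑ u
          ≡⟨ solve 1 (λ s → con 2ℚ :* s := s :+ s) refl (∑ u) ⟩
        ∑ u + ∑ u
          ≡⟨ cong₂ _+_ (∑-cong sums-on-H) (trans (sym (∑-translate u h)) (∑-cong on-H+h)) ⟩
        ∑ (λ z → ⟦ H z ⟧ * u z) + ∑ (λ z → ⟦ H z ⟧ * u (z ⊕ h))
          ≡⟨ sym (∑-+ _ _) ⟩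
        ∑ (λ z → ⟦ H z ⟧ * u z + ⟦ H z ⟧ * u (z ⊕ h))
          ≤⟨ ∑-mono (λ z → subst (_≤ℚ ⟦ H z ⟧ * card (A ∩ B)) (ℚ.*-distribˡ-+ ⟦ H z ⟧ (u z) (u (z ⊕ h)))
                             (*-monoˡ ⟦ H z ⟧ 0≤⟦ H z ⟧ (pair≤ z))) ⟩
        ∑ (λ z → ⟦ H z ⟧ * card (A ∩ B))
          ≡⟨ ∑-*ʳ (card (A ∩ B)) (λ z → ⟦ H z ⟧) ⟩
        card H * card (A ∩ B) ∎
        where
        open ℚ.≤-Reasoning
        u = sums A B
        on-H+h : ∀ z → u (z ⊕ h) ≡ ⟦ H z ⟧ * u (z ⊕ h)
        on-H+h z = trans (sums-on-H (z ⊕ h)) (cong (λ b → ⟦ b ⟧ * u (z ⊕ h)) (shift SH h∈H z))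
        rearrange : ∀ z a b → z ⊕ a ⊕ (z ⊕ h ⊕ b) ≡ h ⊕ (a ⊕ b)
        rearrange z a b = trans (cong₂ _⊕_ (⊕-comm z a) (⊕-assoc z h b))
          (trans (⊕-assoc a z _) (trans (cong (a ⊕_) (⊕-cancelˡ z _))
            (trans (sym (⊕-assoc a h b)) (trans (cong (_⊕ b) (⊕-comm a h)) (⊕-assoc h a b)))))
        pair≤ : ∀ z → u z + u (z ⊕ h) ≤ℚ card (A ∩ B)
        pair≤ z with search (λ a → A a ∧ B (z ⊕ a))
        ... | inj₂ none = subst (λ s → s + u (z ⊕ h) ≤ℚ card (A ∩ B)) (sym (card-empty none))
                (subst (_≤ℚ card (A ∩ B)) (sym (ℚ.+-identityˡ (u (z ⊕ h)))) (sums≤ (z ⊕ h)))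
        ... | inj₁ (a , both) = subst (λ s → u z + s ≤ℚ card (A ∩ B)) (sym (card-empty none))
                (subst (_≤ℚ card (A ∩ B)) (sym (ℚ.+-identityʳ (u z))) (sums≤ z))
          where
          none : ∀ b → A b ∧ B (z ⊕ h ⊕ b) ≡ false
          none b = ¬true⇒false _ (λ both′ →
            let a∈A , za∈B = ∧-true⁻ (A a) both ; b∈A , zhb∈B = ∧-true⁻ (A b) both′
            in contradiction (trans (sym (uncovered (closed SA a∈A b∈A)))
                 (trans (cong B (sym (rearrange z a b))) (closed SB za∈B zhb∈B))) (λ ()))

  adjoin : Pred → Vec Bool m → Pred
  adjoin K a x = K x ∨ K (x ⊕ a)

  module _ {K : Pred} (SK : IsSubgroup K) (a : Vec Bool m) where

    adjoin-isSubgroup : IsSubgroup (adjoin K a)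
    adjoin-isSubgroup .𝟎∈ rewrite 𝟎∈ SK = refl
    adjoin-isSubgroup .closed {x} {y} x∈ y∈ with K x in x? | K y in y?
    ... | true | true rewrite closed SK x? y? = refl
    ... | false | true rewrite trans (cong K (⊕-swapʳ x y a)) (trans (shift SK y? (x ⊕ a)) x∈) = Bool.∨-zeroʳ _
    ... | true | false rewrite trans (cong K (trans (⊕-assoc x y a) (⊕-comm x (y ⊕ a)))) (trans (shift SK x? (y ⊕ a)) y∈) = Bool.∨-zeroʳ _
    ... | false | false rewrite trans (cong K (sym (trans (cong (x ⊕ a ⊕_) (⊕-comm y a)) (trans (sym (⊕-assoc (x ⊕ a) a y)) (cong (_⊕ y) (⊕-cancelʳ x a)))))) (closed SK x∈ y∈) = refl

    card-adjoin : K a ≡ false → card (adjoin K a) ≡ 2ℚ * card K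
    card-adjoin a∉K = trans (∑-cong split)
      (trans (∑-+ _ _) (trans (cong (λ z → card K + z) (∑-translate (λ x → ⟦ K x ⟧) a))
        (solve 1 (λ s → s :+ s := con 2ℚ :* s) refl (card K))))
      where
      split : ∀ x → ⟦ K x ∨ K (x ⊕ a) ⟧ ≡ ⟦ K x ⟧ + ⟦ K (x ⊕ a) ⟧
      split x with K x in x? | K (x ⊕ a) in xa?
      ... | false | false = refl
      ... | false | true = refl
      ... | true | false = refl
      ... | true | true = contradiction
              (trans (sym a∉K) (trans (cong K (sym (⊕-cancelˡ x a))) (closed SK x? xa?))) (λ ())

    adjoin-⊆ : ∀ {H} → IsSubgroup H → K ⊆ H → a ∈ H → adjoin K a ⊆ H
    adjoin-⊆ {H} SH K⊆H a∈H {x} x∈ with K x in x?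
    ... | true = K⊆H x?
    ... | false = trans (sym (shift SH a∈H x)) (K⊆H x∈)

  -- The index of a subgroup is a power of two.
  index-gap : ∀ c {K H} → IsSubgroup K → IsSubgroup H → K ⊆ H →
              card H ≤ℚ 2ℚ ^ c * card K ⊎ 2ℚ ^ suc c * card K ≤ℚ card H
  index-gap c {K} {H} SK SH K⊆H with search (λ x → H x ∧ not (K x))
  index-gap c {K} {H} SK SH K⊆H | inj₂ none = inj₁ (ℚ.≤-trans (card-mono H⊆K) (≤2^* c (card≥0 K)))
    where
    H⊆K : H ⊆ K
    H⊆K {x} x∈H with K x | H x | none x
    ... | true | _ | _ = refl
    ... | false | false | _ = x∈H
  index-gap c {K} {H} SK SH K⊆H | inj₁ (a , both) = go c
    where
    a∈H = proj₁ (∧-true⁻ (H a) both)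
    a∉K : K a ≡ false
    a∉K = trans (sym (Bool.not-involutive (K a))) (cong not (proj₂ (∧-true⁻ (H a) both)))
    double : ∀ p → p * card (adjoin K a) ≡ 2ℚ * p * card K
    double p = trans (cong (p *_) (card-adjoin SK a a∉K))
      (solve 2 (λ p k → p :* (con 2ℚ :* k) := con 2ℚ :* p :* k) refl p (card K))
    bigger : adjoin K a ⊆ H
    bigger = adjoin-⊆ SK a SH K⊆H a∈H
    go : ∀ c → card H ≤ℚ 2ℚ ^ c * card K ⊎ 2ℚ ^ suc c * card K ≤ℚ card H
    go zero = inj₂ (subst (_≤ℚ card H) (trans (sym (ℚ.*-identityˡ _)) (double 1ℚ)) (card-mono bigger))
    go (suc c) with index-gap c (adjoin-isSubgroup SK a) SH bigger
    ... | inj₁ le = inj₁ (subst (card H ≤ℚ_) (double (2ℚ ^ c)) le)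
    ... | inj₂ ge = inj₂ (subst (_≤ℚ card H) (double (2ℚ ^ suc c)) ge)

-- Quadratic functions

Fn : ℕ → Set
Fn m = Vec 𝔽₂ m → 𝔽₂

infixr 6 _⊞_
_⊞_ : ∀ {m} → Fn m → Fn m → Fn m
(f ⊞ g) x = f x xor g x

D : ∀ {m} → Vec Bool m → Fn m → Fn m
D a f x = f (x ⊕ a) xor f x

-- Degree through iterated derivatives: the k-fold ones vanish. Unlike a bound on coefficients, this
-- is visibly stable under sums and translations, and for quadratics it yields directly the
-- vanishing third derivative on which `charSum-dichotomy` rests.
data Degree< {m} : ℕ → Fn m → Set where
  vanishing  : ∀ {f} → (∀ x → f x ≡ false) → Degree< zero f
  derivative : ∀ {k f} → (∀ a → Degree< k (D a f)) → Degree< (suc k) f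

xor-interchange : ∀ a b c d → (a xor b) xor (c xor d) ≡ (a xor c) xor (b xor d)
xor-interchange false false c d = refl
xor-interchange false true false d = refl
xor-interchange false true true d = refl
xor-interchange true false false d = refl
xor-interchange true false true d = Bool.not-involutive d
xor-interchange true true false d = sym (Bool.not-involutive d)
xor-interchange true true true d = refl

xor≡false⇒≡ : ∀ {a b} → a xor b ≡ false → a ≡ b
xor≡false⇒≡ {true} {true} _ = refl
xor≡false⇒≡ {false} {false} _ = refl

module _ {m : ℕ} where

  Degree<-cong : ∀ {k} {f g : Fn m} → (∀ x → f x ≡ g x) → Degree< k f → Degree< k g
  Degree<-cong f≗g (vanishing f≡0) = vanishing (λ x → trans (sym (f≗g x)) (f≡0 x))
  Degree<-cong f≗g (derivative df) = derivative (λ a →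
    Degree<-cong (λ x → cong₂ _xor_ (f≗g (x ⊕ a)) (f≗g x)) (df a))

  Degree<-⊞ : ∀ {k} {f g : Fn m} → Degree< k f → Degree< k g → Degree< k (f ⊞ g)
  Degree<-⊞ (vanishing f≡0) (vanishing g≡0) = vanishing (λ x → cong₂ _xor_ (f≡0 x) (g≡0 x))
  Degree<-⊞ {f = f} {g} (derivative df) (derivative dg) = derivative (λ a → Degree<-cong
    (λ x → xor-interchange (f (x ⊕ a)) (f x) (g (x ⊕ a)) (g x)) (Degree<-⊞ (df a) (dg a)))

  Degree<-suc : ∀ {k} {f : Fn m} → Degree< k f → Degree< (suc k) f
  Degree<-suc (vanishing f≡0) = derivative (λ a → vanishing (λ x → cong₂ _xor_ (f≡0 (x ⊕ a)) (f≡0 x)))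
  Degree<-suc (derivative df) = derivative (λ a → Degree<-suc (df a))

  Degree<-mono : ∀ {j k} {f : Fn m} → j ≤ k → Degree< j f → Degree< k f
  Degree<-mono {k = zero} z≤n df = df
  Degree<-mono {k = suc k} z≤n df = Degree<-suc (Degree<-mono z≤n df)
  Degree<-mono (s≤s j≤k) (derivative df) = derivative (λ a → Degree<-mono j≤k (df a))

  Degree<-shift : ∀ {k} {f : Fn m} b → Degree< k f → Degree< k (λ x → f (b ⊕ x))
  Degree<-shift b (vanishing f≡0) = vanishing (λ x → f≡0 (b ⊕ x))
  Degree<-shift {f = f} b (derivative df) = derivative (λ a → Degree<-cong
    (λ x → cong (λ y → f y xor f (b ⊕ x)) (⊕-assoc b x a)) (Degree<-shift b (df a)))

  Degree<-const : ∀ b → Degree< {m} 1 (λ _ → b)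
  Degree<-const b = derivative (λ _ → vanishing (λ _ → Bool.xor-same b))

  Degree<-false : ∀ {k} → Degree< {m} k (λ _ → false)
  Degree<-false = Degree<-mono z≤n (vanishing (λ _ → refl))

  Degree<-∧ : ∀ {k} {f : Fn m} b → Degree< k f → Degree< k (λ x → b ∧ f x)
  Degree<-∧ true df = df
  Degree<-∧ false df = Degree<-false

Degree<-tail : ∀ {m k} {f : Fn m} → Degree< k f → Degree< k (f ∘ tail)
Degree<-tail (vanishing f≡0) = vanishing (λ { (_ ∷ x) → f≡0 x })
Degree<-tail (derivative df) = derivative (λ { (_ ∷ a) →
  Degree<-cong (λ { (_ ∷ x) → refl }) (Degree<-tail (df a)) })

-- Product rule: the derivative of x₀ f(x) in direction (b, a) is x₀ (D a f)(x) + b f(x + a). The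
-- first term is covered by induction, the second has the degree of f.
Degree<-head∧ : ∀ {m k} {f : Fn m} → Degree< k f → Degree< (suc k) (λ x → head x ∧ f (tail x))
Degree<-head∧ (vanishing f≡0) = Degree<-suc (vanishing (λ { (b ∷ x) →
  trans (cong (b ∧_) (f≡0 x)) (Bool.∧-zeroʳ b) }))
Degree<-head∧ {f = f} f-deg@(derivative df) = derivative (λ { (b ∷ a) → Degree<-cong (product-rule b a)
  (Degree<-⊞ (Degree<-head∧ (df a))
    (Degree<-∧ b (Degree<-tail (Degree<-cong (λ x → cong f (⊕-comm a x)) (Degree<-shift a f-deg))))) })
  where
  bits : ∀ x b p q → (x ∧ (p xor q)) xor (b ∧ p) ≡ ((x xor b) ∧ p) xor (x ∧ q)
  bits false false p q = refl
  bits false true p q = sym (Bool.xor-identityʳ p)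
  bits true false p q = Bool.xor-identityʳ _
  bits true true false q = Bool.xor-identityʳ q
  bits true true true false = refl
  bits true true true true = refl
  product-rule : ∀ b a x → (head x ∧ D a f (tail x)) xor (b ∧ f (tail x ⊕ a))
               ≡ D (b ∷ a) (λ y → head y ∧ f (tail y)) x
  product-rule b a (x ∷ xs) = bits x b (f (xs ⊕ a)) (f xs)

Degree<-monomial : ∀ {m} (S : Subset m) → Degree< (suc Subset.∣ S ∣) (monomial S)
Degree<-monomial [] = Degree<-cong (λ { [] → refl }) (Degree<-const true)
Degree<-monomial (false ∷ S) = Degree<-cong (λ { (_ ∷ x) → refl }) (Degree<-tail (Degree<-monomial S))
Degree<-monomial (true ∷ S) = Degree<-cong (λ { (_ ∷ x) → refl }) (Degree<-head∧ (Degree<-monomial S))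

Degree<-polynomial : ∀ {m d} {f : Fn m} → IsPolynomialOfDegree≤ d f → Degree< (suc d) f
Degree<-polynomial {m} {d} (p , deg-p , f≗p) =
  Degree<-cong (λ x → sym (f≗p x)) (go (cube m))
  where
  term : ∀ S → Degree< (suc d) (λ x → p S ∧ monomial S x)
  term S with p S in eq
  ... | false = Degree<-false
  ... | true = Degree<-mono (s≤s (deg-p S eq)) (Degree<-monomial S)
  go : ∀ Ss → Degree< (suc d) (λ x → foldr _xor_ false (map (λ S → p S ∧ monomial S x) Ss))
  go [] = Degree<-false
  go (S ∷ Ss) = Degree<-⊞ (term S) (go Ss)

Quadratic : ∀ {m} → Fn m → Set
Quadratic = Degree< 3

every : ∀ {m} → Fn m → Bool
every p = [ const false , const true ]′ (search (not ∘ p))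

every⁺ : ∀ {m} {p : Fn m} → (∀ x → p x ≡ true) → every p ≡ true
every⁺ {p = p} all with search (not ∘ p)
... | inj₁ (x , ¬px) = contradiction (trans (sym ¬px) (cong not (all x))) (λ ())
... | inj₂ _ = refl

every⁻ : ∀ {m} {p : Fn m} → every p ≡ true → ∀ x → p x ≡ true
every⁻ {p = p} all x with search (not ∘ p)
every⁻ {p = p} () x | inj₁ _
... | inj₂ none = trans (sym (Bool.not-involutive (p x))) (cong not (none x))

∨-false⁻ : ∀ a {b} → not (not a ∨ b) ≡ true → a ≡ true × b ≡ false
∨-false⁻ true {false} _ = refl , refl

≡-neg⇒≡0 : ∀ {p} → p ≡ - p → p ≡ 0ℚ
≡-neg⇒≡0 {p} eq = trans (solve 1 (λ p → p := con ½ :* (p :+ p)) refl p)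
  (trans (cong (λ q → ½ * (p + q)) eq) (solve 1 (λ p → con ½ :* (p :+ :- p) := con 0ℚ) refl p))

module _ {m : ℕ} where

  -- The disjunction is the Boolean form of an implication: D a g has to vanish on H, while the
  -- values of g off H are ignored. For a translate of f and H a stabiliser, these are the periods
  -- of f on one coset.
  periods : Pred {m} → Fn m → Pred
  periods H g a = H a ∧ every (λ h → not (H h) ∨ not (D a g h))

  charSum : Pred {m} → Fn m → ℚ
  charSum H g = ∑ (λ h → ⟦ H h ⟧ * sgn (g h))

  module _ {H : Pred {m}} (SH : IsSubgroup H) where
    open IsSubgroup

    periods⁻ : ∀ g {a h} → a ∈ periods H g → h ∈ H → g (h ⊕ a) ≡ g h
    periods⁻ g {a} {h} a∈ h∈H
      with H h | h∈H | g (h ⊕ a) | g h | every⁻ (proj₂ (∧-true⁻ (H a) a∈)) h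
    ... | true | _ | false | false | _ = refl
    ... | true | _ | true | true | _ = refl

    periods⁺ : ∀ g {a} → a ∈ H → (∀ {h} → h ∈ H → g (h ⊕ a) ≡ g h) → a ∈ periods H g
    periods⁺ g {a} a∈H const = ∧-true⁺ a∈H (every⁺ point)
      where
      point : ∀ h → not (H h) ∨ not (D a g h) ≡ true
      point h with H h in eq
      ... | false = refl
      ... | true rewrite const eq | Bool.xor-same (g h) = refl

    periods⊆ : ∀ g → periods H g ⊆ H
    periods⊆ g {a} = proj₁ ∘ ∧-true⁻ (H a)

    periods-isSubgroup : ∀ g → IsSubgroup (periods H g)
    periods-isSubgroup g .𝟎∈ = periods⁺ g (𝟎∈ SH) (λ {h} _ → cong g (⊕-identityʳ h))
    periods-isSubgroup g .closed {x} {y} x∈ y∈ =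
      periods⁺ g (closed SH (periods⊆ g x∈) (periods⊆ g y∈)) (λ {h} h∈H →
        trans (cong g (sym (⊕-assoc h x y)))
          (trans (periods⁻ g y∈ (closed SH h∈H (periods⊆ g x∈))) (periods⁻ g x∈ h∈H)))

    module _ {g : Fn m} where

      corr : Vec Bool m → ℚ
      corr a = ∑ (λ h → ⟦ H h ⟧ * sgn (D a g h))

      -- The pairs in H × H are indexed by one member and the difference a of the two.
      charSum² : charSum H g * charSum H g ≡ ∑ (λ a → ⟦ H a ⟧ * corr a)
      charSum² = begin
        charSum H g * charSum H g
          ≡⟨ sym (∑-*ʳ (charSum H g) _) ⟩
        ∑ (λ h → ⟦ H h ⟧ * sgn (g h) * charSum H g)
          ≡⟨ ∑-cong row ⟩
        ∑ (λ h → ∑ (λ a → ⟦ H a ⟧ * (⟦ H h ⟧ * sgn (D a g h))))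
          ≡⟨ ∑-swap _ ⟩
        ∑ (λ a → ∑ (λ h → ⟦ H a ⟧ * (⟦ H h ⟧ * sgn (D a g h))))
          ≡⟨ ∑-cong (λ a → ∑-*ˡ ⟦ H a ⟧ _) ⟩
        ∑ (λ a → ⟦ H a ⟧ * corr a) ∎
        where
        open ≡-Reasoning
        row : ∀ h → ⟦ H h ⟧ * sgn (g h) * charSum H g ≡ ∑ (λ a → ⟦ H a ⟧ * (⟦ H h ⟧ * sgn (D a g h)))
        row h with H h in h?
        ... | false = trans (cong (_* charSum H g) (ℚ.*-zeroˡ (sgn (g h)))) (trans (ℚ.*-zeroˡ (charSum H g))
                (sym (trans (∑-cong (λ a → trans (cong (⟦ H a ⟧ *_) (ℚ.*-zeroˡ (sgn (D a g h)))) (ℚ.*-zeroʳ ⟦ H a ⟧))) (∑-0 m))))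
        ... | true = trans (cong (1ℚ * sgn (g h) *_) (sym (∑-translate _ h)))
                (trans (sym (∑-*ˡ (1ℚ * sgn (g h)) _)) (∑-cong entry))
          where
          entry : ∀ a → 1ℚ * sgn (g h) * (⟦ H (a ⊕ h) ⟧ * sgn (g (a ⊕ h))) ≡ ⟦ H a ⟧ * (1ℚ * sgn (D a g h))
          entry a rewrite shift SH h? a | ⊕-comm a h | sgn-xor (g (h ⊕ a)) (g h) =
            solve 3 (λ s i t → con 1ℚ :* s :* (i :* t) := i :* (con 1ℚ :* (t :* s))) refl
              (sgn (g h)) ⟦ H a ⟧ (sgn (g (h ⊕ a)))

      sgn-not : ∀ b → sgn (not b) ≡ - sgn b
      sgn-not true = refl
      sgn-not false = refl

      -- Translation by e preserves H and turns the sum into its negative.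
      antiperiodic⇒≡0 : ∀ f {e} → e ∈ H → (∀ {h} → h ∈ H → f (h ⊕ e) ≡ not (f h)) → charSum H f ≡ 0ℚ
      antiperiodic⇒≡0 f {e} e∈H anti = ≡-neg⇒≡0 (trans (sym (∑-translate _ e))
        (trans (∑-cong flip) (trans (∑-*ˡ (- 1ℚ) _) (solve 1 (λ s → con (- 1ℚ) :* s := :- s) refl (charSum H f)))))
        where
        flip : ∀ h → ⟦ H (h ⊕ e) ⟧ * sgn (f (h ⊕ e)) ≡ - 1ℚ * (⟦ H h ⟧ * sgn (f h))
        flip h rewrite shift SH e∈H h with H h in eq
        ... | true rewrite anti eq | sgn-not (f h) =
              solve 1 (λ s → con 1ℚ :* :- s := con (- 1ℚ) :* (con 1ℚ :* s)) refl (sgn (f h))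
        ... | false = solve 2 (λ s t → con 0ℚ :* t := con (- 1ℚ) :* (con 0ℚ :* s)) refl (sgn (f h)) (sgn (f (h ⊕ e)))

      -- The derivatives of g are affine, so each is constant or balanced on H.
      charSum-dichotomy : Quadratic g → charSum H g ≡ 0ℚ ⊎
                          charSum H g * charSum H g ≡ card H * card (periods H g)
      charSum-dichotomy (derivative d¹) with search (λ a → H a ∧ every (λ h → not (H h) ∨ D a g h))
      ... | inj₁ (a , both) = inj₁ (antiperiodic⇒≡0 g (proj₁ (∧-true⁻ (H a) both)) anti)
        where
        anti : ∀ {h} → h ∈ H → g (h ⊕ a) ≡ not (g h)
        anti {h} h∈H with H h | h∈H | g (h ⊕ a) | g h | every⁻ (proj₂ (∧-true⁻ (H a) both)) h
        ... | true | _ | false | true | _ = refl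
        ... | true | _ | true | false | _ = refl
      ... | inj₂ none = inj₂ (trans charSum² (trans (∑-cong term) (∑-*ˡ (card H) _)))
        where
        third : ∀ a b c x → D c (D b (D a g)) x ≡ false
        third a b c x with d¹ a
        ... | derivative d² with d² b
        ...   | derivative d³ with d³ c
        ...     | vanishing eq = eq x
        term : ∀ a → ⟦ H a ⟧ * corr a ≡ card H * ⟦ periods H g a ⟧
        term a with H a in a? | none a
        ... | false | _ = trans (ℚ.*-zeroˡ (corr a)) (sym (ℚ.*-zeroʳ (card H)))
        ... | true | not-anti with search (λ h → not (not (H h) ∨ not (D a g h)))
        ...   | inj₂ per = trans (ℚ.*-identityˡ (corr a)) (trans (∑-cong all-one) (sym (ℚ.*-identityʳ (card H))))
          where
          all-one : ∀ h → ⟦ H h ⟧ * sgn (D a g h) ≡ ⟦ H h ⟧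
          all-one h with H h | D a g h | per h
          ... | false | b | _ = ℚ.*-zeroˡ (sgn b)
          ... | true | false | _ = refl
        ...   | inj₁ (h₀ , ¬per) with search (λ h → not (not (H h) ∨ D a g h))
        ...     | inj₁ (h₁ , ¬anti) = trans (ℚ.*-identityˡ (corr a))
                    (trans (antiperiodic⇒≡0 (D a g) (closed SH (proj₁ at-h₀) (proj₁ at-h₁)) alternates)
                           (sym (ℚ.*-zeroʳ (card H))))
          where
          at-h₀ : H h₀ ≡ true × D a g h₀ ≡ true
          at-h₀ = let h₀∈H , eq = ∨-false⁻ (H h₀) ¬per
                  in h₀∈H , trans (sym (Bool.not-involutive _)) (cong not eq)
          at-h₁ : H h₁ ≡ true × D a g h₁ ≡ false
          at-h₁ = ∨-false⁻ (H h₁) ¬anti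
          e = h₀ ⊕ h₁
          -- The third derivative vanishes, so D e (D a g) is constant. At h₁ it compares the values
          -- of D a g at h₀ and h₁, which differ.
          jump : ∀ h → D e (D a g) h ≡ true
          jump h = trans (cong (D e (D a g)) (sym (⊕-cancelˡ h₁ h)))
            (trans (xor≡false⇒≡ (third a e (h₁ ⊕ h) h₁))
              (cong₂ _xor_ (trans (cong (D a g) (trans (⊕-comm h₁ e) (⊕-cancelʳ h₀ h₁))) (proj₂ at-h₀))
                           (proj₂ at-h₁)))
          alternates : ∀ {h} → h ∈ H → D a g (h ⊕ e) ≡ not (D a g h)
          alternates {h} _ with D a g (h ⊕ e) | D a g h | jump h
          ... | true | false | _ = refl
          ... | false | true | _ = refl
        ...     | inj₂ _ = contradiction not-anti (λ ())

-- Bias and periods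

0<^ : ∀ {p} → 0ℚ < p → ∀ n → 0ℚ < p ^ n
0<^ 0<p zero = ℚ.positive⁻¹ 1ℚ
0<^ 0<p (suc n) = 0<-* 0<p (0<^ 0<p n)

square-cancel-≤ : ∀ {x y} → 0ℚ ≤ℚ y → x * x ≤ℚ y * y → x ≤ℚ y
square-cancel-≤ {x} {y} 0≤y x²≤y² = ℚ.≮⇒≥ λ y<x →
  contradiction (ℚ.≤-<-trans (ℚ.≤-trans x²≤y² (*-monoˡ y 0≤y (ℚ.<⇒≤ y<x)))
                             (ℚ.*-monoˡ-<-pos x {{positive (ℚ.≤-<-trans 0≤y y<x)}} y<x))
                (ℚ.<-irrefl refl)

-- If the periods have index at most 8, then S² ≥ |H|²/8 > (49/400)|H|²; otherwise the index is at
-- least 16 and S² ≤ |H|²/16. Zero and negative sums fall under the first alternative.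
charSum-gap : ∀ {m} {H : Pred {m}} → IsSubgroup H → ∀ {g} → Quadratic g →
              charSum H g ≤ℚ + 1 / 4 * card H ⊎ + 7 / 20 * card H ≤ℚ charSum H g
charSum-gap {m} {H} SH {g} quad with charSum H g ℚ.≤? + 1 / 4 * card H
... | yes small = inj₁ small
... | no big with charSum-dichotomy SH quad
...   | inj₁ S≡0 = contradiction (subst (_≤ℚ + 1 / 4 * card H) (sym S≡0)
                     (0≤-* {+ 1 / 4} (ℚ.≤ᵇ⇒≤ _) (card≥0 H))) big
...   | inj₂ S² with index-gap 3 (periods-isSubgroup SH g) SH (λ {x} → periods⊆ SH g {x})
...     | inj₁ ≤8 = inj₂ (square-cancel-≤ (ℚ.<⇒≤ 0<S) (begin
            + 7 / 20 * card H * (+ 7 / 20 * card H)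
              ≡⟨ solve 1 (λ h → con (+ 7 / 20) :* h :* (con (+ 7 / 20) :* h) := con (+ 49 / 400) :* h :* h) refl (card H) ⟩
            + 49 / 400 * card H * card H
              ≤⟨ *-monoˡ (+ 49 / 400 * card H) (0≤-* {+ 49 / 400} (ℚ.≤ᵇ⇒≤ _) (card≥0 H)) ≤8 ⟩
            + 49 / 400 * card H * (2ℚ ^ 3 * card (periods H g))
              ≤⟨ ≤-by (+ 8 / 400 * (card H * card (periods H g)))
                   (0≤-* {+ 8 / 400} (ℚ.≤ᵇ⇒≤ _) (0≤-* (card≥0 H) (card≥0 (periods H g))))
                   (solve 2 (λ h k → con (+ 49 / 400) :* h :* (con (2ℚ ^ 3) :* k) :+ con (+ 8 / 400) :* (h :* k) := h :* k) refl (card H) (card (periods H g))) ⟩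
            card H * card (periods H g)
              ≡⟨ sym S² ⟩
            charSum H g * charSum H g ∎))
  where
  open ℚ.≤-Reasoning
  0<S : 0ℚ < charSum H g
  0<S = ℚ.≤-<-trans (0≤-* {+ 1 / 4} (ℚ.≤ᵇ⇒≤ _) (card≥0 H)) (ℚ.≰⇒> big)
...     | inj₂ 16≤ = inj₁ (square-cancel-≤ (0≤-* {+ 1 / 4} (ℚ.≤ᵇ⇒≤ _) (card≥0 H)) (begin
            charSum H g * charSum H g
              ≡⟨ S² ⟩
            card H * card (periods H g)
              ≡⟨ solve 2 (λ h k → h :* k := con (+ 1 / 16) :* h :* (con (2ℚ ^ 4) :* k)) refl (card H) (card (periods H g)) ⟩
            + 1 / 16 * card H * (2ℚ ^ 4 * card (periods H g))
              ≤⟨ *-monoˡ (+ 1 / 16 * card H) (0≤-* {+ 1 / 16} (ℚ.≤ᵇ⇒≤ _) (card≥0 H)) 16≤ ⟩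
            + 1 / 16 * card H * card H
              ≡⟨ solve 1 (λ h → con (+ 1 / 16) :* h :* h := con (+ 1 / 4) :* h :* (con (+ 1 / 4) :* h)) refl (card H) ⟩
            + 1 / 4 * card H * (+ 1 / 4 * card H) ∎))
  where open ℚ.≤-Reasoning

module _ {m : ℕ} where
  open IsSubgroup

  full : Pred {m}
  full _ = true

  full-isSubgroup : IsSubgroup full
  full-isSubgroup .𝟎∈ = refl
  full-isSubgroup .closed _ _ = refl

  signSum : Fn m → ℚ
  signSum f = ∑ (λ x → sgn (f x))

  charSum-full : ∀ f → charSum full f ≡ signSum f
  charSum-full f = ∑-cong (λ x → ℚ.*-identityˡ (sgn (f x)))

  inv : Fn m → Pred
  inv = periods full

  inv-isSubgroup : ∀ f → IsSubgroup (inv f)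
  inv-isSubgroup = periods-isSubgroup full-isSubgroup

  inv⁻ : ∀ f {a} → a ∈ inv f → ∀ x → f (x ⊕ a) ≡ f x
  inv⁻ f a∈ x = periods⁻ full-isSubgroup f {h = x} a∈ refl

  stab : List (Fn m) → Pred
  stab [] = full
  stab (f ∷ F) = inv f ∩ stab F

  stab-isSubgroup : ∀ F → IsSubgroup (stab F)
  stab-isSubgroup [] = full-isSubgroup
  stab-isSubgroup (f ∷ F) = ∩-isSubgroup (inv-isSubgroup f) (stab-isSubgroup F)

  Biased : ℚ → Fn m → Set
  Biased δ f = δ * ∣𝔽₂^ m ∣ ≤ℚ ∣ signSum f ∣

  ∣p∣²≡p² : ∀ p → ∣ p ∣ * ∣ p ∣ ≡ p * p
  ∣p∣²≡p² p with ℚ.∣p∣≡p∨∣p∣≡-p p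
  ... | inj₁ eq = cong₂ _*_ eq eq
  ... | inj₂ eq = trans (cong₂ _*_ eq eq) (solve 1 (λ p → :- p :* :- p := p :* p) refl p)

  card-inv : ∀ {δ f} → 0ℚ < δ → Quadratic f → Biased δ f → δ * δ * ∣𝔽₂^ m ∣ ≤ℚ card (inv f)
  card-inv {δ} {f} 0<δ quad biased with charSum-dichotomy full-isSubgroup quad
  ... | inj₁ S≡0 = contradiction
          (ℚ.<-≤-trans (0<-* 0<δ 0<∣𝔽₂^ m ∣) (subst (λ s → δ * ∣𝔽₂^ m ∣ ≤ℚ ∣ s ∣) (trans (sym (charSum-full f)) S≡0) biased))
          (ℚ.<-irrefl refl)
  ... | inj₂ S² = *-cancelʳ ∣𝔽₂^ m ∣ 0<∣𝔽₂^ m ∣ (begin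
      δ * δ * N * N        ≡⟨ solve 2 (λ d n → d :* d :* n :* n := d :* n :* (d :* n)) refl δ N ⟩
      δ * N * (δ * N)      ≤⟨ *-mono 0≤δN (ℚ.0≤∣p∣ (signSum f)) biased biased ⟩
      ∣ signSum f ∣ * ∣ signSum f ∣ ≡⟨ ∣p∣²≡p² (signSum f) ⟩
      signSum f * signSum f ≡⟨ cong₂ _*_ (sym (charSum-full f)) (sym (charSum-full f)) ⟩
      charSum full f * charSum full f ≡⟨ S² ⟩
      N * card (inv f)     ≡⟨ ℚ.*-comm N _ ⟩
      card (inv f) * N     ∎)
    where
    open ℚ.≤-Reasoning
    N = ∣𝔽₂^ m ∣
    0≤δN : 0ℚ ≤ℚ δ * N
    0≤δN = ℚ.<⇒≤ (0<-* 0<δ 0<∣𝔽₂^ m ∣)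

  -- The freedom that f retains on the cosets of `stab F`. The exponent r is the quantity that drops
  -- in every round.
  Index≤2^ : ℕ → List (Fn m) → Fn m → Set
  Index≤2^ r F f = card (stab F) ≤ℚ 2ℚ ^ r * card (stab (f ∷ F))

  -- Passing to a smaller subgroup A of H cannot raise the index, because A/(A ∩ B) embeds in H/B;
  -- `card-∩` is the counting form of this.
  Index-∷ : ∀ {r F g} f → Index≤2^ r F g → Index≤2^ r (f ∷ F) g
  Index-∷ {r} {F} {g} f index = *-cancelʳ (card B) (0<card (stab-isSubgroup (g ∷ F))) (begin
    card A * card B            ≤⟨ card-∩ SA (stab-isSubgroup (g ∷ F)) (stab-isSubgroup F) (λ {x} → proj₂ ∘ ∧-true⁻ (inv f x)) (λ {x} → proj₂ ∘ ∧-true⁻ (inv g x)) ⟩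
    card H * card (A ∩ B)      ≤⟨ *-mono (card≥0 (A ∩ B)) (0≤-* (0≤^ 0≤2 r) (card≥0 B)) index (card-mono ∩⊆) ⟩
    2ℚ ^ r * card B * card (inv g ∩ A) ≡⟨ solve 3 (λ a b c → a :* b :* c := a :* c :* b) refl (2ℚ ^ r) (card B) (card (inv g ∩ A)) ⟩
    2ℚ ^ r * card (inv g ∩ A) * card B ∎)
    where
    open ℚ.≤-Reasoning
    H = stab F
    A = stab (f ∷ F)
    B = stab (g ∷ F)
    SA = stab-isSubgroup (f ∷ F)
    ∩⊆ : A ∩ B ⊆ inv g ∩ A
    ∩⊆ {x} x∈ = let x∈A , x∈B = ∧-true⁻ (A x) x∈ in ∧-true⁺ (proj₁ (∧-true⁻ (inv g x) x∈B)) x∈A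

  -- Indices multiply at most under intersection, and each biased function contributes at most δ⁻².
  card-stab : ∀ {δ F} → 0ℚ < δ → ListAll.All (λ f → Quadratic f × Biased δ f) F →
              (δ * δ) ^ length F * ∣𝔽₂^ m ∣ ≤ℚ card (stab F)
  card-stab 0<δ ListAll.[] = ℚ.≤-reflexive (ℚ.*-identityˡ ∣𝔽₂^ m ∣)
  card-stab {δ} {f ∷ F} 0<δ ((quad , biased) ListAll.∷ all) = *-cancelʳ N 0<∣𝔽₂^ m ∣ (begin
    δ * δ * e * N * N          ≡⟨ solve 3 (λ d e n → d :* e :* n :* n := d :* n :* (e :* n)) refl (δ * δ) e N ⟩
    δ * δ * N * (e * N)        ≤⟨ *-mono (0≤-* (0≤^ 0≤δ² (length F)) (ℚ.<⇒≤ 0<∣𝔽₂^ m ∣)) (card≥0 (inv f)) (card-inv 0<δ quad biased) (card-stab 0<δ all) ⟩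
    card (inv f) * card (stab F) ≤⟨ card-∩ (inv-isSubgroup f) (stab-isSubgroup F) full-isSubgroup (λ _ → refl) (λ _ → refl) ⟩
    N * card (stab (f ∷ F))    ≡⟨ ℚ.*-comm N _ ⟩
    card (stab (f ∷ F)) * N    ∎)
    where
    open ℚ.≤-Reasoning
    N = ∣𝔽₂^ m ∣
    e = (δ * δ) ^ length F
    0≤δ² = ℚ.<⇒≤ (0<-* 0<δ 0<δ)

-- Likelihood tests

outputs : ∀ {m n} → Vec (Fn m) n → Vec Bool m → Vec Bool n
outputs L x = Vec.map (λ f → f x) L

ber : ∀ {n} → Distribution n
ber {n} = Ber (+ 1 / 3) ^⊗ n

0≤ber : ∀ {n} (y : Vec Bool n) → 0ℚ ≤ℚ ber y
0≤ber [] = 0≤1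
0≤ber (false ∷ y) = 0≤-* {Ber (+ 1 / 3) false} (ℚ.≤ᵇ⇒≤ _) (0≤ber y)
0≤ber (true ∷ y) = 0≤-* {Ber (+ 1 / 3) true} (ℚ.≤ᵇ⇒≤ _) (0≤ber y)

-- The test accepts strings that look like outputs of L. Misses are counted over the inputs, hence
-- the factor `∣𝔽₂^ m ∣`.
record Distinguisher {m n} (L : Vec (Fn m) n) (ε : ℚ) : Set where
  field
    test  : Vec Bool n → Bool
    miss  : ∑ (λ x → ⟦ not (test (outputs L x)) ⟧) ≤ℚ ε * ∣𝔽₂^ m ∣
    alarm : ∑ (λ y → ber y * ⟦ test y ⟧) ≤ℚ ε

-- Weights close to the square root of the likelihood ratio of Ber(1/3) against
-- a bit that is 1 with probability at least 3/8 (hi) or at most 13/40 (lo).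
data Weight : Set where
  hi lo : Weight

opaque

  φ ψ : Weight → Bool → ℚ
  -- Rational stand-ins for √(8/9), √(16/15), √(40/39) and √(80/81); the `ψ` are their exact
  -- inverses.
  φ hi true  = + 33 / 35
  φ hi false = + 63 / 61
  φ lo true  = + 80 / 79
  φ lo false = + 161 / 162
  ψ hi true  = + 35 / 33
  ψ hi false = + 61 / 63
  ψ lo true  = + 79 / 80
  ψ lo false = + 162 / 161

  -- A common bound for the mean of `ψ` under Ber(1/3) and the means of `φ` on the two sides. The
  -- exact square roots would give about 0.99996 in the tighter case `lo`, so β lies just above
  -- that.
  β : ℚ
  β = + 49999 / 50000

  0≤β : 0ℚ ≤ℚ β
  0≤β = ℚ.≤ᵇ⇒≤ _

  β≤1 : β ≤ℚ 1ℚ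
  β≤1 = ℚ.≤ᵇ⇒≤ _

  β≤1-η : β ≤ℚ 1ℚ - + 1 / 50000
  β≤1-η = ℚ.≤ᵇ⇒≤ _

  0≤φ : ∀ w b → 0ℚ ≤ℚ φ w b
  0≤φ hi true  = ℚ.≤ᵇ⇒≤ _
  0≤φ hi false = ℚ.≤ᵇ⇒≤ _
  0≤φ lo true  = ℚ.≤ᵇ⇒≤ _
  0≤φ lo false = ℚ.≤ᵇ⇒≤ _

  0≤ψ : ∀ w b → 0ℚ ≤ℚ ψ w b
  0≤ψ hi true  = ℚ.≤ᵇ⇒≤ _
  0≤ψ hi false = ℚ.≤ᵇ⇒≤ _
  0≤ψ lo true  = ℚ.≤ᵇ⇒≤ _
  0≤ψ lo false = ℚ.≤ᵇ⇒≤ _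

  φψ≡1 : ∀ w b → φ w b * ψ w b ≡ 1ℚ
  φψ≡1 hi true  = refl
  φψ≡1 hi false = refl
  φψ≡1 lo true  = refl
  φψ≡1 lo false = refl

  Ber-ψ≤β : ∀ w → Ber (+ 1 / 3) false * ψ w false + Ber (+ 1 / 3) true * ψ w true ≤ℚ β
  Ber-ψ≤β hi = ℚ.≤ᵇ⇒≤ _
  Ber-ψ≤β lo = ℚ.≤ᵇ⇒≤ _

  mean diff : Weight → ℚ
  mean w = ½ * (φ w false + φ w true)
  diff w = ½ * (φ w false - φ w true)

  φ-sgn : ∀ w b → φ w b ≡ mean w + diff w * sgn b
  φ-sgn hi true  = refl
  φ-sgn hi false = refl
  φ-sgn lo true  = refl
  φ-sgn lo false = refl

  0≤mean-hi : 0ℚ ≤ℚ mean hi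
  0≤mean-hi = ℚ.≤ᵇ⇒≤ _

  0≤diff-hi : 0ℚ ≤ℚ diff hi
  0≤diff-hi = ℚ.≤ᵇ⇒≤ _

  mean-hi≤β : mean hi ≤ℚ β
  mean-hi≤β = ℚ.≤ᵇ⇒≤ _

  max-hi≤2β : (mean hi + diff hi) * ½ ≤ℚ β
  max-hi≤2β = ℚ.≤ᵇ⇒≤ _

  -- u c + v s is the total of a weight over c points with sign sum s. It is affine in s, so only
  -- the endpoint s = k c of the allowed range has to be checked. For `lo` the slope v is negative
  -- and the range extends upwards.
  affine-gap : ∀ {u v k c} s → 0ℚ ≤ℚ c → u + v * k ≤ℚ β → v * s ≤ℚ v * (k * c) → u * c + v * s ≤ℚ β * c
  affine-gap {u} {v} {k} {c} s 0≤c bound le = ℚ.≤-trans (ℚ.+-monoʳ-≤ (u * c) le)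
    (subst (_≤ℚ β * c) (solve 4 (λ u v k c → (u :+ v :* k) :* c := u :* c :+ v :* (k :* c)) refl u v k c)
           (*-monoʳ c 0≤c bound))

  hi-gap : ∀ {c s} → 0ℚ ≤ℚ c → s ≤ℚ + 1 / 4 * c → mean hi * c + diff hi * s ≤ℚ β * c
  hi-gap {c} {s} 0≤c s≤ = affine-gap {mean hi} {diff hi} {+ 1 / 4} s 0≤c (ℚ.≤ᵇ⇒≤ _) (*-monoˡ (diff hi) (ℚ.≤ᵇ⇒≤ _) s≤)

  lo-gap : ∀ {c s} → 0ℚ ≤ℚ c → + 7 / 20 * c ≤ℚ s → mean lo * c + diff lo * s ≤ℚ β * c
  lo-gap {c} {s} 0≤c ≤s = affine-gap {mean lo} {diff lo} {+ 7 / 20} s 0≤c (ℚ.≤ᵇ⇒≤ _) (ℚ.*-monoˡ-≤-nonPos (diff lo) ≤s)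

product : ∀ {n} → (Weight → Bool → ℚ) → Vec Weight n → Vec Bool n → ℚ
product χ [] [] = 1ℚ
product χ (w ∷ ws) (b ∷ y) = χ w b * product χ ws y

0≤product : ∀ {χ n} → (∀ w b → 0ℚ ≤ℚ χ w b) → (ws : Vec Weight n) → ∀ y → 0ℚ ≤ℚ product χ ws y
0≤product 0≤χ [] [] = 0≤1
0≤product 0≤χ (w ∷ ws) (b ∷ y) = 0≤-* (0≤χ w b) (0≤product 0≤χ ws y)

product-φψ : ∀ {n} (ws : Vec Weight n) y → product φ ws y * product ψ ws y ≡ 1ℚ
product-φψ [] [] = refl
product-φψ (w ∷ ws) (b ∷ y) = trans
  (solve 4 (λ a b c d → a :* b :* (c :* d) := a :* c :* (b :* d)) refl (φ w b) (product φ ws y) (ψ w b) (product ψ ws y))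
  (cong₂ _*_ (φψ≡1 w b) (product-φψ ws y))

infix 5 _≤?ᵇ_
opaque

  _≤?ᵇ_ : ℚ → ℚ → Bool
  p ≤?ᵇ q = does (p ℚ.≤? q)

  ≤?ᵇ-true : ∀ {p q} → p ≤?ᵇ q ≡ true → p ≤ℚ q
  ≤?ᵇ-true {p} {q} = holds (p ℚ.≤? q)
    where
    holds : ∀ {P : Set} (P? : Dec P) → does P? ≡ true → P
    holds (yes p) _ = p

  ≤?ᵇ-false : ∀ {p q} → p ≤?ᵇ q ≡ false → q < p
  ≤?ᵇ-false {p} {q} eq = ℚ.≰⇒> (fails (p ℚ.≤? q) eq)
    where
    fails : ∀ {P : Set} (P? : Dec P) → does P? ≡ false → ¬ P
    fails (no ¬p) _ = ¬p

likely : ∀ {n} → Vec Weight n → Vec Bool n → Bool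
likely ws y = 1ℚ ≤?ᵇ product ψ ws y

-- The Chernoff step: the indicator of {ψ ≥ 1} is at most ψ, and by φψ = 1 that of its complement is
-- at most φ. Products of weights thus bound both kinds of error.
⟦likely⟧≤ψ : ∀ {n} (ws : Vec Weight n) y → ⟦ likely ws y ⟧ ≤ℚ product ψ ws y
⟦likely⟧≤ψ ws y with 1ℚ ≤?ᵇ product ψ ws y in eq
... | true = ≤?ᵇ-true eq
... | false = 0≤product 0≤ψ ws y

⟦unlikely⟧≤φ : ∀ {n} (ws : Vec Weight n) y → ⟦ not (likely ws y) ⟧ ≤ℚ product φ ws y
⟦unlikely⟧≤φ ws y with 1ℚ ≤?ᵇ product ψ ws y in eq
... | true = 0≤product 0≤φ ws y
... | false = subst₂ _≤ℚ_ (product-φψ ws y) (ℚ.*-identityʳ (product φ ws y))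
                (*-monoˡ (product φ ws y) (0≤product 0≤φ ws y) (ℚ.<⇒≤ (≤?ᵇ-false eq)))

∑-ber-ψ : ∀ {n} (ws : Vec Weight n) → ∑ (λ y → ber y * product ψ ws y) ≤ℚ β ^ n
∑-ber-ψ [] = ℚ.≤-reflexive (∑-zero _)
∑-ber-ψ {suc n} (w ∷ ws) = begin
  ∑ (λ y → ber y * product ψ (w ∷ ws) y)
    ≡⟨ ∑-suc n _ ⟩
  ∑ (λ y → B false * ber y * (ψ w false * product ψ ws y)) + ∑ (λ y → B true * ber y * (ψ w true * product ψ ws y))
    ≡⟨ cong₂ _+_ (half false) (half true) ⟩
  B false * ψ w false * s + B true * ψ w true * s
    ≡⟨ sym (ℚ.*-distribʳ-+ s (B false * ψ w false) (B true * ψ w true)) ⟩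
  (B false * ψ w false + B true * ψ w true) * s
    ≤⟨ *-mono 0≤s 0≤β (Ber-ψ≤β w) (∑-ber-ψ ws) ⟩
  β * β ^ n ∎
  where
  open ℚ.≤-Reasoning
  B = Ber (+ 1 / 3)
  s = ∑ (λ y → ber y * product ψ ws y)
  0≤s : 0ℚ ≤ℚ s
  0≤s = ∑-≥0 (λ y → 0≤-* (0≤ber y) (0≤product 0≤ψ ws y))
  half : ∀ b → ∑ (λ y → B b * ber y * (ψ w b * product ψ ws y)) ≡ B b * ψ w b * s
  half b = trans (∑-cong (λ y → interchange (B b) (ber y) (ψ w b) (product ψ ws y))) (∑-*ˡ (B b * ψ w b) _)
    where
    interchange : ∀ p q r t → p * q * (r * t) ≡ p * r * (q * t)
    interchange = solve 4 (λ p q r t → p :* q :* (r :* t) := p :* r :* (q :* t)) refl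

some : ∀ {m} → Pred {m} → Bool
some p = [ const true , const false ]′ (search p)

some⁺ : ∀ {m} (p : Pred {m}) {x} → p x ≡ true → some p ≡ true
some⁺ p {x} px with search p
... | inj₁ _ = refl
... | inj₂ none = contradiction (trans (sym px) (none x)) (λ ())

some⁻ : ∀ {m} (p : Pred {m}) → some p ≡ true → ∃[ x ] p x ≡ true
some⁻ p eq with search p
... | inj₁ found = found
some⁻ p () | inj₂ _

-- Functions independent on cosets

infixr 5 _◁_
_◁_ : ∀ {m n} → Vec (Fn m) n → List (Fn m) → List (Fn m)
L ◁ F = Vec.foldr′ _∷_ F L

module _ {m : ℕ} (F : List (Fn m)) where
  open IsSubgroup

  -- On every coset of stab F, f is then independent of the functions in L.
  Independent : ∀ {n} → Vec (Fn m) n → Fn m → Set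
  Independent L f = ∀ {h} → h ∈ stab F → ∃[ a ] (a ∈ stab (L ◁ F) × (h ⊕ a) ∈ inv f)

  Chain : ∀ {n} → Vec (Fn m) n → Set
  Chain [] = ⊤
  Chain (f ∷ L) = Independent L f × Chain L

  ◁⊆ : ∀ {n} (L : Vec (Fn m) n) → stab (L ◁ F) ⊆ stab F
  ◁⊆ [] x∈ = x∈
  ◁⊆ (f ∷ L) {x} x∈ = ◁⊆ L (proj₂ (∧-true⁻ (inv f x) x∈))

  outputs-◁ : ∀ {n} (L : Vec (Fn m) n) {a} → a ∈ stab (L ◁ F) → ∀ x → outputs L (x ⊕ a) ≡ outputs L x
  outputs-◁ [] _ x = refl
  outputs-◁ (f ∷ L) {a} a∈ x =
    let a∈f , a∈L = ∧-true⁻ (inv f a) a∈ in cong₂ _∷_ (inv⁻ f a∈f x) (outputs-◁ L a∈L x)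

  private
    H = stab F
    SH = stab-isSubgroup F

  ∑H : (Vec Bool m → ℚ) → ℚ
  ∑H p = ∑ (λ h → ⟦ H h ⟧ * p h)

  0≤∑H : ∀ {p} → (∀ x → 0ℚ ≤ℚ p x) → 0ℚ ≤ℚ ∑H p
  0≤∑H 0≤p = ∑-≥0 (λ h → 0≤-* 0≤⟦ H h ⟧ (0≤p h))

  guard : ∀ h {p q : ℚ} → (h ∈ H → p ≡ q) → ⟦ H h ⟧ * p ≡ ⟦ H h ⟧ * q
  guard h {p} {q} eq with H h
  ... | true = cong (1ℚ *_) (eq refl)
  ... | false = trans (ℚ.*-zeroˡ p) (sym (ℚ.*-zeroˡ q))

  ∑H-translate : ∀ p {a} → a ∈ H → ∑H (λ h → p (h ⊕ a)) ≡ ∑H p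
  ∑H-translate p {a} a∈H = trans (∑-cong (λ h → cong (λ b → ⟦ b ⟧ * p (h ⊕ a)) (sym (shift SH a∈H h))))
                                 (∑-translate (λ h → ⟦ H h ⟧ * p h) a)

  -- Both p(h)r(h) and p(h + k)r(h) have the same sum over H: move h by some
  -- a with r unaffected and k + a a period of p.
  ∑H-independent : ∀ {A B : Pred} {p r : Vec Bool m → ℚ} → A ⊆ H →
    (∀ {k} → k ∈ H → ∃[ a ] (a ∈ A × (k ⊕ a) ∈ B)) →
    (∀ {b} → b ∈ B → ∀ h → p (h ⊕ b) ≡ p h) → (∀ {a} → a ∈ A → ∀ h → r (h ⊕ a) ≡ r h) →
    card H * ∑H (λ h → p h * r h) ≡ ∑H p * ∑H r
  ∑H-independent {p = p} {r} A⊆H cover p-inv r-inv = begin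
    card H * ∑H (λ h → p h * r h)
      ≡⟨ sym (∑-*ʳ (∑H (λ h → p h * r h)) (λ k → ⟦ H k ⟧)) ⟩
    ∑H (λ k → ∑H (λ h → p h * r h))
      ≡⟨ ∑-cong (λ k → guard k shifted) ⟩
    ∑H (λ k → ∑H (λ h → p (h ⊕ k) * r h))
      ≡⟨ ∑-cong (λ k → sym (∑-*ˡ ⟦ H k ⟧ _)) ⟩
    ∑ (λ k → ∑ (λ h → ⟦ H k ⟧ * (⟦ H h ⟧ * (p (h ⊕ k) * r h))))
      ≡⟨ ∑-swap _ ⟩
    ∑ (λ h → ∑ (λ k → ⟦ H k ⟧ * (⟦ H h ⟧ * (p (h ⊕ k) * r h))))
      ≡⟨ ∑-cong (λ h → trans (∑-cong (λ k → regroup ⟦ H k ⟧ ⟦ H h ⟧ (p (h ⊕ k)) (r h))) (∑-*ˡ (⟦ H h ⟧ * r h) _)) ⟩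
    ∑ (λ h → ⟦ H h ⟧ * r h * ∑H (λ k → p (h ⊕ k)))
      ≡⟨ ∑-cong (λ h → trans (ℚ.*-assoc ⟦ H h ⟧ (r h) _) (trans (guard h (λ h∈H → cong (r h *_) (recentred h∈H))) (sym (ℚ.*-assoc ⟦ H h ⟧ (r h) _)))) ⟩
    ∑ (λ h → ⟦ H h ⟧ * r h * ∑H p)
      ≡⟨ ∑-*ʳ (∑H p) _ ⟩
    ∑H r * ∑H p
      ≡⟨ ℚ.*-comm (∑H r) (∑H p) ⟩
    ∑H p * ∑H r ∎
    where
    open ≡-Reasoning
    regroup : ∀ a b c d → a * (b * (c * d)) ≡ b * d * (a * c)
    regroup = solve 4 (λ a b c d → a :* (b :* (c :* d)) := b :* d :* (a :* c)) refl
    recentred : ∀ {h} → h ∈ H → ∑H (λ k → p (h ⊕ k)) ≡ ∑H p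
    recentred {h} h∈H = trans (∑-cong (λ k → cong (λ z → ⟦ H k ⟧ * p z) (⊕-comm h k))) (∑H-translate p h∈H)
    shifted : ∀ {k} → k ∈ H → ∑H (λ h → p h * r h) ≡ ∑H (λ h → p (h ⊕ k) * r h)
    shifted {k} k∈H with cover k∈H
    ... | a , a∈A , ka∈B = trans (sym (∑H-translate _ (A⊆H a∈A))) (∑-cong (λ h → cong (⟦ H h ⟧ *_)
            (cong₂ _*_ (trans (cong p (sym (trans (⊕-assoc h k (k ⊕ a)) (cong (h ⊕_) (⊕-cancelˡ k a))))) (p-inv ka∈B (h ⊕ k)))
                       (r-inv a∈A h))))

  -- Depends on x only through its coset. `hi` is taken whenever its mean on the coset is at most β;
  -- failing that, `charSum-gap` guarantees that `lo` works.
  weight : Vec Bool m → Fn m → Weight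
  weight x f = if ∑H (λ h → φ hi (f (x ⊕ h))) ≤?ᵇ β * card H then hi else lo

  weight-shift : ∀ {h} → h ∈ H → ∀ x f → weight (x ⊕ h) f ≡ weight x f
  weight-shift {h} h∈H x f = cong (λ s → if s ≤?ᵇ β * card H then hi else lo) sums-agree
    where
    sums-agree : ∑H (λ k → φ hi (f (x ⊕ h ⊕ k))) ≡ ∑H (λ k → φ hi (f (x ⊕ k)))
    sums-agree = trans (∑-cong (λ k → cong (λ z → ⟦ H k ⟧ * φ hi (f z)) (trans (⊕-assoc x h k) (cong (x ⊕_) (⊕-comm h k)))))
                       (∑H-translate (λ k → φ hi (f (x ⊕ k))) h∈H)

  ∑H-φ : ∀ w f → ∑H (λ h → φ w (f h)) ≡ mean w * card H + diff w * charSum H f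
  ∑H-φ w f = trans (∑-cong (λ h → trans (cong (⟦ H h ⟧ *_) (φ-sgn w (f h))) (regroup ⟦ H h ⟧ (mean w) (diff w) (sgn (f h)))))
    (trans (∑-+ _ _) (cong₂ _+_ (∑-*ˡ (mean w) _) (∑-*ˡ (diff w) _)))
    where
    regroup : ∀ i u v s → i * (u + v * s) ≡ u * i + v * (i * s)
    regroup = solve 4 (λ i u v s → i :* (u :+ v :* s) := u :* i :+ v :* (i :* s)) refl

  weight-gap : ∀ x {f} → Quadratic f → ∑H (λ h → φ (weight x f) (f (x ⊕ h))) ≤ℚ β * card H
  weight-gap x {f} quad with ∑H (λ h → φ hi (f (x ⊕ h))) ≤?ᵇ β * card H in eq
  ... | true = ≤?ᵇ-true eq
  ... | false with charSum-gap SH (Degree<-shift x quad)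
  ...   | inj₁ small = contradiction
            (ℚ.<-≤-trans (≤?ᵇ-false eq) (subst (_≤ℚ β * card H) (sym (∑H-φ hi (λ h → f (x ⊕ h)))) (hi-gap (card≥0 H) small)))
            (ℚ.<-irrefl refl)
  ...   | inj₂ large = subst (_≤ℚ β * card H) (sym (∑H-φ lo (λ h → f (x ⊕ h)))) (lo-gap (card≥0 H) large)

  weights : ∀ {n} → Vec (Fn m) n → Vec Bool m → Vec Weight n
  weights L x = Vec.map (weight x) L

  weights-shift : ∀ {n h} → h ∈ H → (L : Vec (Fn m) n) → ∀ x → weights L (x ⊕ h) ≡ weights L x
  weights-shift h∈H [] x = refl
  weights-shift h∈H (f ∷ L) x = cong₂ _∷_ (weight-shift h∈H x f) (weights-shift h∈H L x)

  -- On a single coset the functions of a chain are independent bits, so the mean of the product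
  -- factors and each factor is at most β.
  chain-product : ∀ {n} (L : Vec (Fn m) n) → All Quadratic L → Chain L → ∀ x →
                  ∑H (λ h → product φ (weights L x) (outputs L (x ⊕ h))) ≤ℚ β ^ n * card H
  chain-product [] [] _ x = ℚ.≤-reflexive (trans (∑-cong (λ h → ℚ.*-identityʳ ⟦ H h ⟧)) (sym (ℚ.*-identityˡ (card H))))
  chain-product {suc n} (f ∷ L) (quad ∷ quads) (indep , chain) x = *-cancelʳ (card H) (0<card SH) (begin
    ∑H (λ h → p h * r h) * card H
      ≡⟨ ℚ.*-comm _ (card H) ⟩
    card H * ∑H (λ h → p h * r h)
      ≡⟨ ∑H-independent (◁⊆ L) indep p-inv r-inv ⟩
    ∑H p * ∑H r
      ≤⟨ *-mono (0≤∑H (λ h → 0≤product 0≤φ (weights L x) (outputs L (x ⊕ h)))) (0≤-* 0≤β (card≥0 H))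
           (weight-gap x quad) (chain-product L quads chain x) ⟩
    β * card H * (β ^ n * card H)
      ≡⟨ solve 3 (λ b c h → b :* h :* (c :* h) := b :* c :* h :* h) refl β (β ^ n) (card H) ⟩
    β ^ suc n * card H * card H ∎)
    where
    open ℚ.≤-Reasoning
    p r : Vec Bool m → ℚ
    p h = φ (weight x f) (f (x ⊕ h))
    r h = product φ (weights L x) (outputs L (x ⊕ h))
    p-inv : ∀ {b} → b ∈ inv f → ∀ h → p (h ⊕ b) ≡ p h
    p-inv b∈ h = cong (φ (weight x f)) (trans (cong f (sym (⊕-assoc x h _))) (inv⁻ f b∈ (x ⊕ h)))
    r-inv : ∀ {a} → a ∈ stab (L ◁ F) → ∀ h → r (h ⊕ a) ≡ r h
    r-inv a∈ h = cong (product φ (weights L x)) (trans (cong (outputs L) (sym (⊕-assoc x h _))) (outputs-◁ L a∈ (x ⊕ h)))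

  -- A string is accepted if the likelihood test of some coset accepts it. A miss at x is already a
  -- miss for the coset of x and costs β^n. A false alarm is summed over all cosets, of which there
  -- are at most 1/γ.
  chain-distinguisher : ∀ {n γ ε} (L : Vec (Fn m) n) → All Quadratic L → Chain L →
    0ℚ ≤ℚ ε → γ * ∣𝔽₂^ m ∣ ≤ℚ card H → β ^ n ≤ℚ γ * ε → Distinguisher L ε
  chain-distinguisher {n} {γ} {ε} L quads chain 0≤ε γN≤H βⁿ≤γε = record
    { test = accept
    ; miss = *-cancelʳ (card H) (0<card SH) (begin
        ∑ (λ x → ⟦ not (accept (outputs L x)) ⟧) * card H
          ≤⟨ *-monoʳ (card H) (card≥0 H) (∑-mono miss-x) ⟩
        ∑ own * card H
          ≡⟨ ℚ.*-comm (∑ own) (card H) ⟩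
        card H * ∑ own
          ≡⟨ sym (∑-*ʳ (∑ own) (λ h → ⟦ H h ⟧)) ⟩
        ∑H (λ h → ∑ own)
          -- Translating x by h in H leaves its weights unchanged, so averaging over h replaces each
          -- x by the mean over its coset.
          ≡⟨ ∑-cong (λ h → guard h (λ h∈H → trans (sym (∑-translate own h)) (∑-cong (λ x → cong (λ ws → product φ ws (outputs L (x ⊕ h))) (weights-shift h∈H L x))))) ⟩
        ∑H (λ h → ∑ (λ x → product φ (weights L x) (outputs L (x ⊕ h))))
          ≡⟨ ∑-cong (λ h → sym (∑-*ˡ ⟦ H h ⟧ _)) ⟩
        ∑ (λ h → ∑ (λ x → ⟦ H h ⟧ * product φ (weights L x) (outputs L (x ⊕ h))))
          ≡⟨ ∑-swap _ ⟩
        ∑ (λ x → ∑H (λ h → product φ (weights L x) (outputs L (x ⊕ h))))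
          ≤⟨ ∑-mono (chain-product L quads chain) ⟩
        ∑ {m} (λ x → β ^ n * card H)
          ≡⟨ ∑-const m (β ^ n * card H) ⟩
        N * (β ^ n * card H)
          ≤⟨ *-monoˡ N 0≤N (*-monoʳ (card H) (card≥0 H) βⁿ≤ε) ⟩
        N * (ε * card H)
          ≡⟨ solve 3 (λ n e h → n :* (e :* h) := e :* n :* h) refl N ε (card H) ⟩
        ε * N * card H ∎)
    ; alarm = *-cancelʳ (card H) (0<card SH) (begin
        ∑ (λ y → ber y * ⟦ accept y ⟧) * card H
          ≡⟨ sym (∑-*ʳ (card H) _) ⟩
        ∑ (λ y → ber y * ⟦ accept y ⟧ * card H)
          ≤⟨ ∑-mono alarm-y ⟩
        ∑ (λ y → ∑ (λ x → ber y * product ψ (weights L x) y))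
          ≡⟨ ∑-swap _ ⟩
        ∑ (λ x → ∑ (λ y → ber y * product ψ (weights L x) y))
          ≤⟨ ∑-mono (λ x → ∑-ber-ψ (weights L x)) ⟩
        ∑ {m} (λ x → β ^ n)
          ≡⟨ ∑-const m (β ^ n) ⟩
        N * β ^ n
          ≤⟨ *-monoˡ N 0≤N βⁿ≤γε ⟩
        N * (γ * ε)
          ≡⟨ solve 3 (λ n g e → n :* (g :* e) := e :* (g :* n)) refl N γ ε ⟩
        ε * (γ * N)
          ≤⟨ *-monoˡ ε 0≤ε γN≤H ⟩
        ε * card H ∎)
    }
    where
    open ℚ.≤-Reasoning
    N = ∣𝔽₂^ m ∣
    0≤N : 0ℚ ≤ℚ N
    0≤N = ℚ.<⇒≤ 0<∣𝔽₂^ m ∣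
    γ≤1 : γ ≤ℚ 1ℚ
    γ≤1 = *-cancelʳ N 0<∣𝔽₂^ m ∣ (ℚ.≤-trans γN≤H (subst (card H ≤ℚ_) (sym (ℚ.*-identityˡ N)) (∑-mono (λ x → ⟦⟧≤1 (H x)))))
    βⁿ≤ε : β ^ n ≤ℚ ε
    βⁿ≤ε = ℚ.≤-trans βⁿ≤γε (subst (γ * ε ≤ℚ_) (ℚ.*-identityˡ ε) (*-monoʳ ε 0≤ε γ≤1))
    own : Vec Bool m → ℚ
    own x = product φ (weights L x) (outputs L x)
    accept : Vec Bool n → Bool
    accept y = some (λ x → likely (weights L x) y)
    miss-x : ∀ x → ⟦ not (accept (outputs L x)) ⟧ ≤ℚ own x
    miss-x x = ℚ.≤-trans (⟦⟧-mono not-accepted) (⟦unlikely⟧≤φ (weights L x) (outputs L x))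
      where
      not-accepted : not (accept (outputs L x)) ≡ true → not (likely (weights L x) (outputs L x)) ≡ true
      not-accepted rejected = cong not (¬true⇒false _ (λ lik → contradiction
        (trans (sym rejected) (cong not (some⁺ (λ z → likely (weights L z) (outputs L x)) lik))) (λ ())))
    alarm-y : ∀ y → ber y * ⟦ accept y ⟧ * card H ≤ℚ ∑ (λ x → ber y * product ψ (weights L x) y)
    alarm-y y with accept y in acc
    ... | false = subst (_≤ℚ ∑ (λ x → ber y * product ψ (weights L x) y))
            (sym (solve 2 (λ b h → b :* con 0ℚ :* h := con 0ℚ) refl (ber y) (card H)))
            (∑-≥0 (λ x → 0≤-* (0≤ber y) (0≤product 0≤ψ (weights L x) y)))
    ... | true with some⁻ _ acc
    -- All of x + H has the weights of x, so one accepting coset supplies |H| terms, each at least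
    -- `ber y`. Summing over points and multiplying by |H| avoids coset representatives.
    ...   | x , lik = begin
      ber y * 1ℚ * card H
        ≡⟨ cong (_* card H) (ℚ.*-identityʳ (ber y)) ⟩
      ber y * card H
        ≤⟨ *-monoˡ (ber y) (0≤ber y) (∑-mono (λ h → ℚ.≤-trans (⟦⟧-mono (λ h∈H →
             trans (cong (λ z → likely (weights L z) y) (⊕-comm h x)) (trans (cong (λ ws → likely ws y) (weights-shift h∈H L x)) lik)))
             (⟦likely⟧≤ψ (weights L (h ⊕ x)) y))) ⟩
      ber y * ∑ (λ h → product ψ (weights L (h ⊕ x)) y)
        ≡⟨ cong (ber y *_) (∑-translate (λ z → product ψ (weights L z) y) x) ⟩
      ber y * ∑ (λ z → product ψ (weights L z) y)
        ≡⟨ sym (∑-*ˡ (ber y) _) ⟩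
      ∑ (λ z → ber y * product ψ (weights L z) y) ∎

-- Biased quadratic functions

-- A choice of s out of n coordinates.
data _⊑_ : ℕ → ℕ → Set where
  done : zero ⊑ zero
  skip : ∀ {s n} → s ⊑ n → s ⊑ suc n
  keep : ∀ {s n} → s ⊑ n → suc s ⊑ suc n

pick : ∀ {A : Set} {s n} → s ⊑ n → Vec A n → Vec A s
pick done [] = []
pick (skip θ) (x ∷ xs) = pick θ xs
pick (keep θ) (x ∷ xs) = x ∷ pick θ xs

pick-all : ∀ {A : Set} {P : A → Set} {s n} (θ : s ⊑ n) {xs : Vec A n} → All P xs → All P (pick θ xs)
pick-all done [] = []
pick-all (skip θ) (p ∷ ps) = pick-all θ ps
pick-all (keep θ) (p ∷ ps) = p ∷ pick-all θ ps

outputs-pick : ∀ {m s n} (θ : s ⊑ n) (L : Vec (Fn m) n) x → outputs (pick θ L) x ≡ pick θ (outputs L x)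
outputs-pick done [] x = refl
outputs-pick (skip θ) (f ∷ L) x = outputs-pick θ L x
outputs-pick (keep θ) (f ∷ L) x = cong (f x ∷_) (outputs-pick θ L x)

∑-ber-suc : ∀ {n} (g : Vec Bool (suc n) → ℚ) → ∑ (λ y → ber y * g y) ≡
            Ber (+ 1 / 3) false * ∑ (λ y → ber y * g (false ∷ y)) + Ber (+ 1 / 3) true * ∑ (λ y → ber y * g (true ∷ y))
∑-ber-suc {n} g = trans (∑-suc n _) (cong₂ _+_ (half false) (half true))
  where
  half : ∀ b → ∑ (λ y → Ber (+ 1 / 3) b * ber y * g (b ∷ y)) ≡ Ber (+ 1 / 3) b * ∑ (λ y → ber y * g (b ∷ y))
  half b = trans (∑-cong (λ y → ℚ.*-assoc (Ber (+ 1 / 3) b) (ber y) (g (b ∷ y)))) (∑-*ˡ (Ber (+ 1 / 3) b) _)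

∑-ber-pick : ∀ {s n} (θ : s ⊑ n) (g : Vec Bool s → ℚ) → ∑ (λ y → ber y * g (pick θ y)) ≡ ∑ (λ y → ber y * g y)
∑-ber-pick done g = trans (∑-zero _) (sym (∑-zero _))
∑-ber-pick (skip θ) g = trans (∑-ber-suc _) (trans
  (solve 1 (λ s → con (Ber (+ 1 / 3) false) :* s :+ con (Ber (+ 1 / 3) true) :* s := s) refl (∑ (λ y → ber y * g (pick θ y))))
  (∑-ber-pick θ g))
∑-ber-pick (keep θ) g = trans (∑-ber-suc _) (trans
  (cong₂ _+_ (cong (Ber (+ 1 / 3) false *_) (∑-ber-pick θ (λ y → g (false ∷ y))))
             (cong (Ber (+ 1 / 3) true *_) (∑-ber-pick θ (λ y → g (true ∷ y)))))
  (sym (∑-ber-suc g)))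

unpick : ∀ {m s n ε} (θ : s ⊑ n) {L : Vec (Fn m) n} → Distinguisher (pick θ L) ε → Distinguisher L ε
unpick {ε = ε} θ {L} dist = record
  { test = λ y → test (pick θ y)
  ; miss = subst (_≤ℚ _) (∑-cong (λ x → cong (λ y → ⟦ not (test y) ⟧) (outputs-pick θ L x))) miss
  ; alarm = subst (_≤ℚ ε) (sym (∑-ber-pick θ (λ y → ⟦ test y ⟧))) alarm
  }
  where open Distinguisher dist

module _ {m : ℕ} {F : List (Fn m)} where

  -- An h in H that no element of A moves into the invariance subgroup of f lies outside A + B. Then
  -- 2|A||B| ≤ |H||A ∩ B|, and dividing by |B| with |H| ≤ 2^r |B| gives the second alternative.
  independent? : ∀ r {n} (L : Vec (Fn m) n) f → Index≤2^ r F f → Independent F L f ⊎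
                 2ℚ * card (stab (L ◁ F)) ≤ℚ 2ℚ ^ r * card (stab (f ∷ (L ◁ F)))
  independent? r L f index with search (λ h → stab F h ∧ every (λ a → not (stab (L ◁ F) a ∧ inv f (h ⊕ a))))
  ... | inj₂ none = inj₁ covered
    where
    covered : Independent F L f
    covered {h} h∈H with search (λ a → stab (L ◁ F) a ∧ inv f (h ⊕ a))
    ... | inj₁ (a , both) = a , ∧-true⁻ (stab (L ◁ F) a) both
    ... | inj₂ uncovered = contradiction
            (trans (sym (∧-true⁺ h∈H (every⁺ (λ a → cong not (uncovered a))))) (none h)) (λ ())
  ... | inj₁ (h , both) = inj₂ (*-cancelʳ (card B) (IsSubgroup.0<card SB) (begin
      2ℚ * card A * card B     ≡⟨ ℚ.*-assoc 2ℚ (card A) (card B) ⟩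
      2ℚ * (card A * card B)   ≤⟨ card-∩-uncovered SA SB (stab-isSubgroup F) (λ {x} → ◁⊆ F L {x}) (λ {x} x∈ → proj₂ (∧-true⁻ (inv f x) x∈)) h∈H uncovered ⟩
      card (stab F) * card (A ∩ B) ≤⟨ *-mono (card≥0 (A ∩ B)) (0≤-* (0≤^ 0≤2 r) (card≥0 B)) index (card-mono ∩⊆) ⟩
      2ℚ ^ r * card B * card C ≡⟨ solve 3 (λ a b c → a :* b :* c := a :* c :* b) refl (2ℚ ^ r) (card B) (card C) ⟩
      2ℚ ^ r * card C * card B ∎))
    where
    open ℚ.≤-Reasoning
    A = stab (L ◁ F)
    B = stab (f ∷ F)
    C = stab (f ∷ (L ◁ F))
    SA = stab-isSubgroup (L ◁ F)
    SB = stab-isSubgroup (f ∷ F)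
    h∈H = proj₁ (∧-true⁻ (stab F h) both)
    uncovered : ∀ {a} → a ∈ A → B (h ⊕ a) ≡ false
    uncovered {a} a∈A with inv f (h ⊕ a) in eq
    ... | false = refl
    ... | true = contradiction (trans (sym (every⁻ (proj₂ (∧-true⁻ (stab F h) both)) a)) (cong not (∧-true⁺ a∈A eq))) (λ ())
    ∩⊆ : A ∩ B ⊆ C
    ∩⊆ {x} x∈ = let x∈A , x∈B = ∧-true⁻ (A x) x∈ in ∧-true⁺ (proj₁ (∧-true⁻ (inv f x) x∈B)) x∈A

  -- At index 1 every function is constant on the cosets, hence independent of anything; halving
  -- once more would give 2|A| ≤ |A|.
  chain-all : ∀ {n} (L : Vec (Fn m) n) → All (Index≤2^ 0 F) L → Chain F L
  chain-all [] [] = tt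
  chain-all (f ∷ L) (index ∷ indices) = [ (λ i → λ {h} → i {h}) , (λ le → contradiction (tooBig le) (ℚ.<-irrefl refl)) ]′
    (independent? 0 L f index) , chain-all L indices
    where
    A = stab (L ◁ F)
    tooBig : 2ℚ * card A ≤ℚ 1ℚ * card (stab (f ∷ (L ◁ F))) → card A < card A
    tooBig le = ℚ.<-≤-trans
      (subst₂ _<_ (ℚ.+-identityʳ (card A)) (solve 1 (λ a → a :+ a := con 2ℚ :* a) refl (card A))
        (ℚ.+-monoʳ-< (card A) (IsSubgroup.0<card (stab-isSubgroup (L ◁ F)))))
      (ℚ.≤-trans le (subst (_≤ℚ card A) (sym (ℚ.*-identityˡ (card (stab (f ∷ (L ◁ F))))))
        (card-mono (λ {x} x∈ → proj₂ (∧-true⁻ (inv f x) x∈)))))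

  -- f is already a member, so intersecting with its invariance subgroup again changes nothing.
  index-self : ∀ r f {n} (L : Vec (Fn m) n) → Index≤2^ r (f ∷ (L ◁ F)) f
  index-self r f L = ℚ.≤-trans
    (card-mono {p = stab (f ∷ (L ◁ F))} (λ {x} x∈ → ∧-true⁺ (proj₁ (∧-true⁻ (inv f x) x∈)) x∈))
    (≤2^* r (card≥0 (stab (f ∷ f ∷ (L ◁ F)))))

  -- A chain that stops short of p is maximal: each function either belongs to it, and has index 1
  -- afterwards, or failed to be independent, and has its index halved.
  grow : ∀ r p {n} (L : Vec (Fn m) n) → All (Index≤2^ (suc r) F) L →
         (∃ λ (θ : p ⊑ n) → Chain F (pick θ L)) ⊎
         ∃[ s ] (s ℕ.< p × ∃ λ (θ : s ⊑ n) → (Chain F (pick θ L) × All (Index≤2^ r (pick θ L ◁ F)) L))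
  grow r zero [] [] = inj₁ (done , tt)
  grow r (suc p) [] [] = inj₂ (zero , s≤s z≤n , done , tt , [])
  grow r p (f ∷ L) (index ∷ indices) with grow r p L indices
  ... | inj₁ (θ , chain) = inj₁ (skip θ , chain)
  ... | inj₂ (s , s<p , θ , chain , halved) with independent? (suc r) (pick θ L) f index
  ...   | inj₂ le = inj₂ (s , s<p , skip θ , chain , ℚ.*-cancelˡ-≤-pos 2ℚ (subst (2ℚ * card (stab (pick θ L ◁ F)) ≤ℚ_)
            (ℚ.*-assoc 2ℚ (2ℚ ^ r) (card (stab (f ∷ (pick θ L ◁ F))))) le) ∷ halved)
  ...   | inj₁ indep with ℕ.m≤n⇒m<n∨m≡n s<p
  ...     | inj₂ refl = inj₁ (keep θ , (λ {h} → indep {h}) , chain)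
  -- Halved indices survive the extension by `Index-∷`, and f itself now has index 1.
  ...     | inj₁ s+1<p = inj₂ (suc s , s+1<p , keep θ , ((λ {h} → indep {h}) , chain) ,
              index-self r f (pick θ L) ∷ All.map (λ {g} → Index-∷ {r = r} {F = pick θ L ◁ F} {g} f) halved)

^-antimono : ∀ {p j k} → 0ℚ ≤ℚ p → p ≤ℚ 1ℚ → j ≤ k → p ^ k ≤ℚ p ^ j
^-antimono {k = zero} 0≤p p≤1 z≤n = ℚ.≤-refl
^-antimono {k = suc k} 0≤p p≤1 z≤n = *-mono (0≤^ 0≤p k) 0≤1 p≤1 (^-antimono {k = k} 0≤p p≤1 z≤n)
^-antimono {p} 0≤p p≤1 (s≤s j≤k) = *-monoˡ p 0≤p (^-antimono 0≤p p≤1 j≤k)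

½^-mono : ∀ {j k} → j ≤ k → ½ ^ k ≤ℚ ½ ^ j
½^-mono = ^-antimono 0≤½ (ℚ.≤ᵇ⇒≤ _)

^-mono : ∀ {p q} → 0ℚ ≤ℚ p → p ≤ℚ q → ∀ k → p ^ k ≤ℚ q ^ k
^-mono 0≤p p≤q zero = ℚ.≤-refl
^-mono 0≤p p≤q (suc k) = *-mono (0≤^ 0≤p k) (ℚ.≤-trans 0≤p p≤q) p≤q (^-mono 0≤p p≤q k)

½^*2^ : ∀ t → ½ ^ t * 2ℚ ^ t ≡ 1ℚ
½^*2^ zero = refl
½^*2^ (suc t) = trans (solve 2 (λ a b → con ½ :* a :* (con 2ℚ :* b) := a :* b) refl (½ ^ t) (2ℚ ^ t)) (½^*2^ t)

module Petals (K : ℕ) (βᴷ≤½ : β ^ K ≤ℚ ½) where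

  β^K*≤½^ : ∀ j → β ^ (K ℕ.* j) ≤ℚ ½ ^ j
  β^K*≤½^ j = subst (_≤ℚ ½ ^ j) (^-assocʳ β K j) (^-mono (0≤^ 0≤β K) βᴷ≤½ j)

  module _ (t κ : ℕ) where

    -- When F has s members, stab F has at most 2^(2ts) cosets; a chain of this
    -- length survives the union bound over them.
    petals : ℕ → ℕ
    petals s = K ℕ.* (s ℕ.* (t ℕ.+ t) ℕ.+ κ)

    -- The length of L that suffices when F has s members and r halvings remain. A failed round adds
    -- fewer than `petals s` members. After the last halving all of L is a chain and must itself
    -- have the length `petals`.
    needed : ℕ → ℕ → ℕ
    needed zero s = petals s
    needed (suc r) s = needed r (petals s ℕ.+ s)

    needed-mono : ∀ r {s s′} → s ≤ s′ → needed r s ≤ needed r s′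
    needed-mono zero s≤ = ℕ.*-monoʳ-≤ K (ℕ.+-monoˡ-≤ κ (ℕ.*-monoˡ-≤ (t ℕ.+ t) s≤))
    needed-mono (suc r) s≤ = needed-mono r (ℕ.+-mono-≤ (needed-mono zero s≤) s≤)

    β^petals≤ : ∀ s → β ^ petals s ≤ℚ (½ ^ t * ½ ^ t) ^ s * ½ ^ κ
    β^petals≤ s = subst (β ^ petals s ≤ℚ_) exponents (β^K*≤½^ (s ℕ.* (t ℕ.+ t) ℕ.+ κ))
      where
      exponents : ½ ^ (s ℕ.* (t ℕ.+ t) ℕ.+ κ) ≡ (½ ^ t * ½ ^ t) ^ s * ½ ^ κ
      exponents = trans (^-homo-* ½ (s ℕ.* (t ℕ.+ t)) κ) (cong (_* ½ ^ κ)
        (trans (cong (½ ^_) (ℕ.*-comm s (t ℕ.+ t))) (trans (sym (^-assocʳ ½ (t ℕ.+ t) s)) (cong (_^ s) (^-homo-* ½ t t)))))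

    0<½^t : 0ℚ < ½ ^ t
    0<½^t = 0<^ (ℚ.positive⁻¹ ½) t

    module _ {m n : ℕ} (L : Vec (Fn m) n) (good : All (λ f → Quadratic f × Biased (½ ^ t) f) L) where

      Good : Fn m → Set
      Good f = Quadratic f × Biased (½ ^ t) f

      ◁-good : ∀ {s F} {M : Vec (Fn m) s} → All Good M → ListAll.All Good F → ListAll.All Good (M ◁ F)
      ◁-good [] goodF = goodF
      ◁-good (g ∷ gs) goodF = g ListAll.∷ ◁-good gs goodF

      ◁-length : ∀ {s F} (M : Vec (Fn m) s) → length (M ◁ F) ≡ s ℕ.+ length F
      ◁-length [] = refl
      ◁-length (f ∷ M) = cong suc (◁-length M)

      distinguish-chain : ∀ {F s} (M : Vec (Fn m) s) → ListAll.All Good F → All Good M → Chain F M →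
                          petals (length F) ≤ s → Distinguisher M (½ ^ κ)
      distinguish-chain {F} M goodF goodM chain enough = chain-distinguisher F {γ = (½ ^ t * ½ ^ t) ^ length F} M (All.map proj₁ goodM) chain
        (0≤^ 0≤½ κ) (card-stab 0<½^t goodF)
        (ℚ.≤-trans (^-antimono 0≤β β≤1 enough) (β^petals≤ (length F)))

      distinguish : ∀ r F → ListAll.All Good F → All (Index≤2^ r F) L → needed r (length F) ≤ n → Distinguisher L (½ ^ κ)
      distinguish zero F goodF indices enough = distinguish-chain L goodF good (chain-all L indices) enough
      distinguish (suc r) F goodF indices enough with grow r (petals (length F)) L indices
      ... | inj₁ (θ , chain) = unpick θ (distinguish-chain (pick θ L) goodF (pick-all θ good) chain ℕ.≤-refl)
      ... | inj₂ (s , s<p , θ , chain , halved) = distinguish r (pick θ L ◁ F) (◁-good (pick-all θ good) goodF) halved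
              (ℕ.≤-trans (needed-mono r (ℕ.≤-trans (ℕ.≤-reflexive (◁-length (pick θ L))) (ℕ.+-monoˡ-≤ (length F) (ℕ.<⇒≤ s<p)))) enough)

      biased-distinguisher : needed (t ℕ.+ t) zero ≤ n → Distinguisher L (½ ^ κ)
      biased-distinguisher = distinguish (t ℕ.+ t) [] ListAll.[] (All.map index good)
        where
        index : ∀ {f} → Good f → Index≤2^ (t ℕ.+ t) [] f
        index {f} (quad , biased) = begin
          N
            ≡⟨ trans (sym (ℚ.*-identityˡ N)) (cong (_* N) (sym (cong₂ _*_ (½^*2^ t) (½^*2^ t)))) ⟩
          ½ ^ t * 2ℚ ^ t * (½ ^ t * 2ℚ ^ t) * N
            ≡⟨ solve 3 (λ a b n → a :* b :* (a :* b) :* n := b :* b :* (a :* a :* n)) refl (½ ^ t) (2ℚ ^ t) N ⟩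
          2ℚ ^ t * 2ℚ ^ t * (½ ^ t * ½ ^ t * N)
            ≤⟨ *-monoˡ (2ℚ ^ t * 2ℚ ^ t) (0≤-* (0≤^ 0≤2 t) (0≤^ 0≤2 t)) (ℚ.≤-trans (card-inv 0<½^t quad biased) (card-mono (λ {x} x∈ → ∧-true⁺ x∈ refl))) ⟩
          2ℚ ^ t * 2ℚ ^ t * card (stab (f ∷ []))
            ≡⟨ cong (_* card (stab (f ∷ []))) (sym (^-homo-* 2ℚ t t)) ⟩
          2ℚ ^ (t ℕ.+ t) * card (stab (f ∷ [])) ∎
          where
          open ℚ.≤-Reasoning
          N = ∣𝔽₂^ m ∣

-- Removing combinations

infixr 7 _·_
_·_ : ∀ {s} → Vec Bool s → Vec Bool s → Bool
[] · [] = false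
(c ∷ cs) · (b ∷ bs) = (c ∧ b) xor (cs · bs)

𝟎· : ∀ {s} (b : Vec Bool s) → 𝟎 · b ≡ false
𝟎· [] = refl
𝟎· (b ∷ bs) = 𝟎· bs

∣∣≤-+ : ∀ {p q r s} → ∣ p ∣ ≤ℚ r → ∣ q ∣ ≤ℚ s → ∣ p + q ∣ ≤ℚ r + s
∣∣≤-+ {p} {q} p≤ q≤ = ℚ.≤-trans (ℚ.∣p+q∣≤∣p∣+∣q∣ p q) (ℚ.+-mono-≤ p≤ q≤)

∣∣≤-* : ∀ {c p r} → 0ℚ ≤ℚ c → ∣ p ∣ ≤ℚ r → ∣ c * p ∣ ≤ℚ c * r
∣∣≤-* {c} {p} {r} 0≤c p≤ = subst (_≤ℚ c * r)
  (sym (trans (ℚ.∣p*q∣≡∣p∣*∣q∣ c p) (cong (_* ∣ p ∣) (ℚ.0≤p⇒∣p∣≡p 0≤c)))) (*-monoˡ c 0≤c p≤)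

p≤∣p∣ : ∀ p → p ≤ℚ ∣ p ∣
p≤∣p∣ p with ℚ.≤-total 0ℚ p
... | inj₁ 0≤p = ℚ.≤-reflexive (sym (ℚ.0≤p⇒∣p∣≡p 0≤p))
... | inj₂ p≤0 = ℚ.≤-trans p≤0 (ℚ.0≤∣p∣ p)

module _ {m : ℕ} where

  combine : ∀ {s} → Vec Bool s → Vec (Fn m) s → Fn m
  combine c B x = c · outputs B x

  combine-quadratic : ∀ {s} (c : Vec Bool s) {B} → All Quadratic B → Quadratic (combine c B)
  combine-quadratic [] [] = Degree<-false
  combine-quadratic (c ∷ cs) (quad ∷ quads) = Degree<-⊞ (Degree<-∧ c quad) (combine-quadratic cs quads)

  -- All nonzero combinations are covered, each at the first function that occurs in it.
  Regular : ℚ → ∀ {s} → Vec (Fn m) s → Set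
  Regular δ [] = ⊤
  Regular δ (f ∷ B) = (∀ c → ∣ signSum (f ⊞ combine c B) ∣ ≤ℚ δ * ∣𝔽₂^ m ∣) × Regular δ B

  Dependent : ℚ → ∀ {s} → Vec (Fn m) s → Fn m → Set
  Dependent δ B f = ∃ λ c → Biased δ (f ⊞ combine c B)

  -- f + f = 0 has bias 1, so members of the family count as dependent as well.
  dependent-self : ∀ {δ s} f (B : Vec (Fn m) s) → δ ≤ℚ 1ℚ → Dependent δ (f ∷ B) f
  dependent-self {δ} f B δ≤1 = (true ∷ 𝟎) , subst (δ * ∣𝔽₂^ m ∣ ≤ℚ_) (cong ∣_∣ sum) (ℚ.≤-trans
    (*-monoʳ ∣𝔽₂^ m ∣ (ℚ.<⇒≤ 0<∣𝔽₂^ m ∣) δ≤1) (ℚ.≤-trans (ℚ.≤-reflexive (ℚ.*-identityˡ ∣𝔽₂^ m ∣)) (p≤∣p∣ ∣𝔽₂^ m ∣)))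
    where
    vanishes : ∀ b → b xor (b xor false) ≡ false
    vanishes true = refl
    vanishes false = refl
    sum : ∣𝔽₂^ m ∣ ≡ signSum (f ⊞ combine (true ∷ 𝟎) (f ∷ B))
    sum = ∑-cong {m} (λ x → sym (cong sgn (trans (cong (λ b → f x xor (f x xor b)) (𝟎· (outputs B x))) (vanishes (f x)))))

  -- A regular family that stops short of t is maximal, so every function outside it completes some
  -- combination of large bias.
  greedy : ∀ {δ} t {n} (L : Vec (Fn m) n) → δ ≤ℚ 1ℚ →
           (∃ λ (θ : t ⊑ n) → Regular δ (pick θ L)) ⊎
           ∃[ s ] (s ℕ.< t × ∃ λ (θ : s ⊑ n) → (Regular δ (pick θ L) × All (Dependent δ (pick θ L)) L))
  greedy zero [] δ≤1 = inj₁ (done , tt)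
  greedy (suc t) [] δ≤1 = inj₂ (zero , s≤s z≤n , done , tt , [])
  greedy {δ} t (f ∷ L) δ≤1 with greedy {δ} t L δ≤1
  ... | inj₁ (θ , regular) = inj₁ (skip θ , regular)
  ... | inj₂ (s , s<t , θ , regular , dependent)
    with search (λ c → δ * ∣𝔽₂^ m ∣ ≤?ᵇ ∣ signSum (f ⊞ combine c (pick θ L)) ∣)
  ...   | inj₁ (c , biased) = inj₂ (s , s<t , skip θ , regular , (c , ≤?ᵇ-true biased) ∷ dependent)
  ...   | inj₂ none with ℕ.m≤n⇒m<n∨m≡n s<t
  ...     | inj₂ refl = inj₁ (keep θ , (λ c → ℚ.<⇒≤ (≤?ᵇ-false (none c))) , regular)
  ...     | inj₁ s+1<t = inj₂ (suc s , s+1<t , keep θ , ((λ c → ℚ.<⇒≤ (≤?ᵇ-false (none c))) , regular) ,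
                dependent-self f (pick θ L) δ≤1 ∷ All.map (λ (c , biased) → (false ∷ c) , biased) dependent)

  u v : ℚ
  u = mean hi
  v = diff hi

  Φ : ∀ {s} → Vec (Fn m) s → Vec Bool m → ℚ
  Φ B x = product φ (replicate _ hi) (outputs B x)

  0≤u+v : 0ℚ ≤ℚ u + v
  0≤u+v = 0≤-+ 0≤mean-hi 0≤diff-hi

  -- Expand ∏ (u + v sgn) over the functions of B.
  ∑-sgn-Φ : ∀ {η s} (B : Vec (Fn m) s) f → (∀ c → ∣ signSum (f ⊞ combine c B) ∣ ≤ℚ η) →
            ∣ ∑ (λ x → sgn (f x) * Φ B x) ∣ ≤ℚ (u + v) ^ s * η
  ∑-sgn-Φ {η} [] f small = subst₂ _≤ℚ_
    (cong ∣_∣ (∑-cong (λ x → trans (cong sgn (Bool.xor-identityʳ (f x))) (sym (ℚ.*-identityʳ (sgn (f x)))))))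
    (sym (ℚ.*-identityˡ η)) (small [])
  ∑-sgn-Φ {η} {suc s} (g ∷ B) f small = subst₂ _≤ℚ_ (cong ∣_∣ (sym expand))
    (solve 4 (λ u v p e → u :* (p :* e) :+ v :* (p :* e) := (u :+ v) :* p :* e) refl u v ((u + v) ^ s) η)
    (∣∣≤-+ {u * ∑ (λ x → sgn (f x) * Φ B x)}
      (∣∣≤-* 0≤mean-hi (∑-sgn-Φ B f (λ c → small (false ∷ c))))
      (∣∣≤-* 0≤diff-hi (∑-sgn-Φ B (f ⊞ g) (λ c → subst (λ p → ∣ p ∣ ≤ℚ η)
        (∑-cong (λ x → cong sgn (sym (Bool.xor-assoc (f x) (g x) (c · outputs B x))))) (small (true ∷ c))))))
    where
    term : ∀ x → sgn (f x) * (φ hi (g x) * Φ B x) ≡ u * (sgn (f x) * Φ B x) + v * (sgn (f x xor g x) * Φ B x)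
    term x = trans (cong (λ w → sgn (f x) * (w * Φ B x)) (φ-sgn hi (g x)))
      (trans (solve 5 (λ a u v b p → a :* ((u :+ v :* b) :* p) := u :* (a :* p) :+ v :* (a :* b :* p)) refl (sgn (f x)) u v (sgn (g x)) (Φ B x))
             (cong (λ w → u * (sgn (f x) * Φ B x) + v * (w * Φ B x)) (sym (sgn-xor (f x) (g x)))))
    expand : ∑ (λ x → sgn (f x) * Φ (g ∷ B) x) ≡ u * ∑ (λ x → sgn (f x) * Φ B x) + v * ∑ (λ x → sgn ((f ⊞ g) x) * Φ B x)
    expand = trans (∑-cong term) (trans (∑-+ _ _) (cong₂ _+_ (∑-*ˡ u _) (∑-*ˡ v _)))

  -- In the expansion of the product of the factors u + v sgn, the empty combination gives u^s, as
  -- for uniform independent bits. Every other one has sign sum at most δ|𝔽₂ᵐ|, and their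
  -- coefficients add up to at most (u + v)^s.
  ∑-Φ : ∀ {δ s} (B : Vec (Fn m) s) → 0ℚ ≤ℚ δ → Regular δ B → ∑ (Φ B) ≤ℚ (u ^ s + (u + v) ^ s * δ) * ∣𝔽₂^ m ∣
  ∑-Φ {δ} [] 0≤δ tt = ≤-by (δ * ∣𝔽₂^ m ∣) (0≤-* 0≤δ (ℚ.<⇒≤ 0<∣𝔽₂^ m ∣))
    (solve 2 (λ d n → n :+ d :* n := (con 1ℚ :+ con 1ℚ :* d) :* n) refl δ ∣𝔽₂^ m ∣)
  ∑-Φ {δ} {suc s} (f ∷ B) 0≤δ (small , regular) = begin
    ∑ (λ x → φ hi (f x) * Φ B x)
      ≡⟨ trans (∑-cong term) (trans (∑-+ _ _) (cong₂ _+_ (∑-*ˡ u _) (∑-*ˡ v _))) ⟩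
    u * ∑ (Φ B) + v * ∑ (λ x → sgn (f x) * Φ B x)
      ≤⟨ ℚ.+-mono-≤ (*-monoˡ u 0≤mean-hi (∑-Φ B 0≤δ regular))
                    (*-monoˡ v 0≤diff-hi (ℚ.≤-trans (p≤∣p∣ _) (∑-sgn-Φ B f small))) ⟩
    u * ((u ^ s + (u + v) ^ s * δ) * N) + v * ((u + v) ^ s * (δ * N))
      ≡⟨ solve 6 (λ u v p q d n → u :* ((p :+ q :* d) :* n) :+ v :* (q :* (d :* n)) := (u :* p :+ (u :+ v) :* q :* d) :* n)
           refl u v (u ^ s) ((u + v) ^ s) δ N ⟩
    (u ^ suc s + (u + v) ^ suc s * δ) * N ∎
    where
    open ℚ.≤-Reasoning
    N = ∣𝔽₂^ m ∣
    term : ∀ x → φ hi (f x) * Φ B x ≡ u * Φ B x + v * (sgn (f x) * Φ B x)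
    term x = trans (cong (_* Φ B x) (φ-sgn hi (f x)))
      (solve 4 (λ u v b p → (u :+ v :* b) :* p := u :* p :+ v :* (b :* p)) refl u v (sgn (f x)) (Φ B x))

  -- Nearly uniform bits are on the `hi` side, so one weight serves every coordinate. The bias 2^-t
  -- outweighs (u + v)^t because u + v is `φ hi false`, close to 1.
  regular-distinguisher : ∀ {t} (B : Vec (Fn m) t) → Regular (½ ^ t) B → Distinguisher B (2ℚ * β ^ t)
  regular-distinguisher {t} B regular = record
    { test = likely (replicate t hi)
    ; miss = ℚ.≤-trans (∑-mono (λ x → ⟦unlikely⟧≤φ (replicate t hi) (outputs B x)))
        (ℚ.≤-trans (∑-Φ B (0≤^ 0≤½ t) regular) (*-monoʳ ∣𝔽₂^ m ∣ (ℚ.<⇒≤ 0<∣𝔽₂^ m ∣) (begin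
          u ^ t + (u + v) ^ t * ½ ^ t  ≡⟨ cong (λ z → u ^ t + z) (sym (^-distrib-* (u + v) ½ t)) ⟩
          u ^ t + ((u + v) * ½) ^ t    ≤⟨ ℚ.+-mono-≤ (^-mono 0≤mean-hi mean-hi≤β t) (^-mono (0≤-* 0≤u+v 0≤½) max-hi≤2β t) ⟩
          β ^ t + β ^ t                ≡⟨ solve 1 (λ b → b :+ b := con 2ℚ :* b) refl (β ^ t) ⟩
          2ℚ * β ^ t                   ∎)))
    ; alarm = begin
        ∑ (λ y → ber y * ⟦ likely (replicate t hi) y ⟧)        ≤⟨ ∑-mono (λ y → *-monoˡ (ber y) (0≤ber y) (⟦likely⟧≤ψ (replicate t hi) y)) ⟩
        ∑ (λ y → ber y * product ψ (replicate t hi) y) ≤⟨ ∑-ber-ψ (replicate t hi) ⟩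
        β ^ t                                           ≤⟨ ≤-by (β ^ t) (0≤^ 0≤β t) (solve 1 (λ b → b :+ b := con 2ℚ :* b) refl (β ^ t)) ⟩
        2ℚ * β ^ t                                      ∎
    }
    where open ℚ.≤-Reasoning

  -- L as it looks on the event that the functions in B take the values b.
  residual : ∀ δ {s n} {B : Vec (Fn m) s} {L : Vec (Fn m) n} → All (Dependent δ B) L → Vec Bool s → Vec (Fn m) n
  residual δ [] b = []
  residual δ {B = B} {f ∷ L} ((c , _) ∷ deps) b = (f ⊞ combine c B ⊞ const (c · b)) ∷ residual δ deps b

  signSum-shift : ∀ (f : Fn m) b → ∣ signSum (f ⊞ const b) ∣ ≡ ∣ signSum f ∣
  signSum-shift f false = cong ∣_∣ (∑-cong (λ x → cong sgn (Bool.xor-identityʳ (f x))))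
  signSum-shift f true = trans (cong ∣_∣ (trans (∑-cong (λ x → trans (sgn-xor (f x) true) (ℚ.*-comm (sgn (f x)) (- 1ℚ)))) (∑-*ˡ (- 1ℚ) _)))
    (trans (ℚ.∣p*q∣≡∣p∣*∣q∣ (- 1ℚ) (signSum f)) (ℚ.*-identityˡ ∣ signSum f ∣))

  residual-good : ∀ δ {s n} {B : Vec (Fn m) s} {L : Vec (Fn m) n} → All Quadratic B → All Quadratic L →
                  (deps : All (Dependent δ B) L) → ∀ b → All (λ f → Quadratic f × Biased δ f) (residual δ deps b)
  residual-good δ quadB [] [] b = []
  residual-good δ {B = B} {f ∷ L} quadB (quad ∷ quads) ((c , biased) ∷ deps) b =
    (Degree<-⊞ quad (Degree<-⊞ (combine-quadratic c quadB) (Degree<-mono (s≤s z≤n) (Degree<-const (c · b)))) ,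
     subst (δ * ∣𝔽₂^ m ∣ ≤ℚ_) (trans (sym (signSum-shift (f ⊞ combine c B) (c · b)))
       (cong ∣_∣ (∑-cong (λ x → cong sgn (Bool.xor-assoc (f x) (combine c B x) (c · b)))))) biased)
    ∷ residual-good δ quadB quads deps b

  outputs-residual : ∀ δ {s n} {B : Vec (Fn m) s} {L : Vec (Fn m) n} (deps : All (Dependent δ B) L) → ∀ x →
                     outputs (residual δ deps (outputs B x)) x ≡ outputs L x
  outputs-residual δ [] x = refl
  outputs-residual δ {B = B} {f ∷ L} ((c , _) ∷ deps) x = cong₂ _∷_
    (trans (cong (f x xor_) (Bool.xor-same (combine c B x))) (Bool.xor-identityʳ (f x))) (outputs-residual δ deps x)

  -- At an input x the residual for b = `outputs B x` agrees with L, so a miss at x is a miss of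
  -- that one test. Residuals are functions on the whole cube, so no conditioning occurs, and
  -- accepting as soon as any test does costs only the number of values b.
  union-distinguisher : ∀ δ {ε s n} {B : Vec (Fn m) s} {L : Vec (Fn m) n} (deps : All (Dependent δ B) L) →
    (∀ b → Distinguisher (residual δ deps b) ε) → Distinguisher L (∣𝔽₂^ s ∣ * ε)
  union-distinguisher δ {ε} {s} {n} {B} {L} deps dist = record
    { test = accept
    ; miss = begin
        ∑ (λ x → ⟦ not (accept (outputs L x)) ⟧)
          ≤⟨ ∑-mono miss-x ⟩
        ∑ (λ x → ∑ (λ b → ⟦ not (test (dist b) (outputs (residual δ deps b) x)) ⟧))
          ≡⟨ ∑-swap (λ x b → ⟦ not (test (dist b) (outputs (residual δ deps b) x)) ⟧) ⟩
        ∑ (λ b → ∑ (λ x → ⟦ not (test (dist b) (outputs (residual δ deps b) x)) ⟧))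
          ≤⟨ ∑-mono (λ b → miss (dist b)) ⟩
        ∑ {s} (λ b → ε * ∣𝔽₂^ m ∣)
          ≡⟨ trans (∑-const s _) (sym (ℚ.*-assoc ∣𝔽₂^ s ∣ ε ∣𝔽₂^ m ∣)) ⟩
        ∣𝔽₂^ s ∣ * ε * ∣𝔽₂^ m ∣ ∎
    ; alarm = begin
        ∑ (λ y → ber y * ⟦ accept y ⟧)
          ≤⟨ ∑-mono (λ y → *-monoˡ (ber y) (0≤ber y) (accept≤ y)) ⟩
        ∑ (λ y → ber y * ∑ (λ b → ⟦ test (dist b) y ⟧))
          ≡⟨ ∑-cong (λ y → sym (∑-*ˡ (ber y) (λ b → ⟦ test (dist b) y ⟧))) ⟩
        ∑ (λ y → ∑ (λ b → ber y * ⟦ test (dist b) y ⟧))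
          ≡⟨ ∑-swap (λ y b → ber y * ⟦ test (dist b) y ⟧) ⟩
        ∑ (λ b → ∑ (λ y → ber y * ⟦ test (dist b) y ⟧))
          ≤⟨ ∑-mono (λ b → alarm (dist b)) ⟩
        ∑ {s} (λ b → ε)
          ≡⟨ ∑-const s ε ⟩
        ∣𝔽₂^ s ∣ * ε ∎
    }
    where
    open ℚ.≤-Reasoning
    open Distinguisher
    accept : Vec Bool n → Bool
    accept y = some (λ b → test (dist b) y)
    accept≤ : ∀ y → ⟦ accept y ⟧ ≤ℚ ∑ (λ b → ⟦ test (dist b) y ⟧)
    accept≤ y with accept y in acc
    ... | false = ∑-≥0 (λ b → 0≤⟦ test (dist b) y ⟧)
    ... | true with some⁻ (λ b → test (dist b) y) acc
    ...   | b , yes-b = ℚ.≤-trans (ℚ.≤-reflexive (cong ⟦_⟧ (sym yes-b))) (term≤∑ (λ b → 0≤⟦ test (dist b) y ⟧) b)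
    miss-x : ∀ x → ⟦ not (accept (outputs L x)) ⟧ ≤ℚ ∑ (λ b → ⟦ not (test (dist b) (outputs (residual δ deps b) x)) ⟧)
    miss-x x = ℚ.≤-trans (⟦⟧-mono rejected)
      (term≤∑ (λ b → 0≤⟦ not (test (dist b) (outputs (residual δ deps b) x)) ⟧) (outputs B x))
      where
      rejected : not (accept (outputs L x)) ≡ true → not (test (dist (outputs B x)) (outputs (residual δ deps (outputs B x)) x)) ≡ true
      rejected eq = cong not (¬true⇒false _ (λ acc → contradiction
        (trans (sym eq) (cong not (some⁺ (λ b → test (dist b) (outputs L x)) {outputs B x}
          (trans (cong (test (dist (outputs B x))) (sym (outputs-residual δ deps x))) acc)))) (λ ())))

weaken : ∀ {m n ε ε′} {L : Vec (Fn m) n} → ε ≤ℚ ε′ → Distinguisher L ε → Distinguisher L ε′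
weaken {m} ε≤ dist = record
  { test = test
  ; miss = ℚ.≤-trans miss (*-monoʳ ∣𝔽₂^ m ∣ (ℚ.<⇒≤ 0<∣𝔽₂^ m ∣) ε≤)
  ; alarm = ℚ.≤-trans alarm ε≤
  }
  where open Distinguisher dist

module Combinatorial (K : ℕ) (βᴷ≤½ : β ^ K ≤ℚ ½) where
  open Petals K βᴷ≤½

  -- t = K(κ + 1) makes the error 2β^t of the regular case at most 2^-κ. The biased case runs with
  -- error 2^-(κ+t), which pays for the 2^s values of the s < t removed functions.
  quadratic-distinguisher : ∀ {m n} κ (L : Vec (Fn m) n) → All Quadratic L → let t = K ℕ.* suc κ in
    needed t (κ ℕ.+ t) (t ℕ.+ t) zero ≤ n → Distinguisher L (½ ^ κ)
  quadratic-distinguisher {m} {n} κ L quads enough with greedy {δ = ½ ^ (K ℕ.* suc κ)} (K ℕ.* suc κ) L (½^-mono {zero} {K ℕ.* suc κ} z≤n)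
  ... | inj₁ (θ , regular) = unpick θ (weaken ε≤ (regular-distinguisher (pick θ L) regular))
    where
    ε≤ : 2ℚ * β ^ (K ℕ.* suc κ) ≤ℚ ½ ^ κ
    ε≤ = ℚ.≤-trans (*-monoˡ 2ℚ 0≤2 (β^K*≤½^ (suc κ))) (ℚ.≤-reflexive
      (solve 1 (λ h → con 2ℚ :* (con ½ :* h) := h) refl (½ ^ κ)))
  ... | inj₂ (s , s<t , θ , _ , deps) = weaken ε≤ (union-distinguisher (½ ^ t) deps (λ b →
        biased-distinguisher t (κ ℕ.+ t) (residual (½ ^ t) deps b) (residual-good (½ ^ t) (pick-all θ quads) quads deps b) enough))
    where
    t = K ℕ.* suc κ
    open ℚ.≤-Reasoning
    ε≤ : ∣𝔽₂^ s ∣ * ½ ^ (κ ℕ.+ t) ≤ℚ ½ ^ κ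
    ε≤ = begin
      ∣𝔽₂^ s ∣ * ½ ^ (κ ℕ.+ t)  ≤⟨ *-monoˡ ∣𝔽₂^ s ∣ (ℚ.<⇒≤ 0<∣𝔽₂^ s ∣) (½^-mono (ℕ.+-monoʳ-≤ κ (ℕ.<⇒≤ s<t))) ⟩
      ∣𝔽₂^ s ∣ * ½ ^ (κ ℕ.+ s)  ≡⟨ cong (∣𝔽₂^ s ∣ *_) (^-homo-* ½ κ s) ⟩
      ∣𝔽₂^ s ∣ * (½ ^ κ * ½ ^ s) ≡⟨ solve 3 (λ n a b → n :* (a :* b) := a :* (b :* n)) refl ∣𝔽₂^ s ∣ (½ ^ κ) (½ ^ s) ⟩
      ½ ^ κ * (½ ^ s * ∣𝔽₂^ s ∣) ≡⟨ trans (cong (λ z → ½ ^ κ * z) (½^-*-∣𝔽₂^∣ s)) (ℚ.*-identityʳ (½ ^ κ)) ⟩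
      ½ ^ κ ∎

-- Total variation distance

∑-ber : ∀ n → ∑ {n} (λ y → ber y * 1ℚ) ≡ 1ℚ
∑-ber zero = ∑-zero _
∑-ber (suc n) = trans (∑-ber-suc {n} (λ _ → 1ℚ))
  (trans (cong (λ s → Ber (+ 1 / 3) false * s + Ber (+ 1 / 3) true * s) (∑-ber n)) refl)

∑-pushforward : ∀ {m n} (F : Vec Bool m → Vec Bool n) c (g : Vec Bool n → ℚ) →
  ∑ (λ y → pushforward F (const c) y * g y) ≡ c * ∑ (λ x → g (F x))
∑-pushforward {m} {n} F c g = begin
  ∑ (λ y → pushforward F (const c) y * g y)
    ≡⟨ ∑-cong (λ y → trans (cong (_* g y) (sym (∑-def (mass y)))) (sym (∑-*ʳ (g y) (mass y)))) ⟩
  ∑ (λ y → ∑ (λ x → mass y x * g y))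
    ≡⟨ ∑-swap (λ y x → mass y x * g y) ⟩
  ∑ (λ x → ∑ (λ y → mass y x * g y))
    ≡⟨ ∑-cong (λ x → trans (∑-single (λ y → mass y x * g y) (F x) (off x)) (cong (_* g (F x)) (on x))) ⟩
  ∑ (λ x → c * g (F x))
    ≡⟨ ∑-*ˡ c (λ x → g (F x)) ⟩
  c * ∑ (λ x → g (F x)) ∎
  where
  open ≡-Reasoning
  mass : Vec Bool n → Vec Bool m → ℚ
  mass y x = if ⌊ Vec.≡-dec Bool._≟_ (F x) y ⌋ then c else 0ℚ
  on : ∀ x → mass (F x) x ≡ c
  on x with Vec.≡-dec Bool._≟_ (F x) (F x)
  ... | yes _ = refl
  ... | no ≢ = contradiction refl ≢
  off : ∀ x y → y ≢ F x → mass y x * g y ≡ 0ℚ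
  off x y y≢ with Vec.≡-dec Bool._≟_ (F x) y
  ... | yes eq = contradiction (sym eq) y≢
  ... | no _ = ℚ.*-zeroˡ (g y)

-p≤∣p∣ : ∀ p → - p ≤ℚ ∣ p ∣
-p≤∣p∣ p = subst (- p ≤ℚ_) (ℚ.∣-p∣≡∣p∣ p) (p≤∣p∣ (- p))

-- Integrate against P - ber the function that is 1 where the test accepts and -1 elsewhere. The
-- integral is at most twice the distance, and each of the two errors lowers it from 2 by twice its
-- mass.
TV-distinguisher : ∀ {m n ε} (Q : Fin n → Vec 𝔽₂ m → 𝔽₂) → Distinguisher (tabulate Q) ε →
                   1ℚ - 2ℚ * ε ≤ℚ TV (outputDistribution Q) (Ber (+ 1 / 3) ^⊗ n)
TV-distinguisher {m} {n} {ε} Q dist = begin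
  1ℚ - 2ℚ * ε
    ≡⟨ solve 1 (λ e → con 1ℚ :- con 2ℚ :* e := con ½ :* (con 1ℚ :+ con (- 2ℚ) :* e :+ (con 1ℚ :+ con (- 2ℚ) :* e))) refl ε ⟩
  ½ * (1ℚ + - 2ℚ * ε + (1ℚ + - 2ℚ * ε))
    ≤⟨ *-monoˡ ½ 0≤½ (ℚ.+-mono-≤ (ℚ.+-monoʳ-≤ 1ℚ (ℚ.*-monoˡ-≤-nonPos (- 2ℚ) miss′)) (ℚ.+-monoʳ-≤ 1ℚ (ℚ.*-monoˡ-≤-nonPos (- 2ℚ) alarm))) ⟩
  ½ * (1ℚ + - 2ℚ * ∑ (λ y → P y * ⟦ not (test y) ⟧) + (1ℚ + - 2ℚ * ∑ (λ y → ber y * ⟦ test y ⟧)))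
    ≡⟨ cong (½ *_) (sym (cong₂ _+_ (split P (λ y → ⟦ not (test y) ⟧) P-total) (split ber (λ y → ⟦ test y ⟧) (∑-ber n)))) ⟩
  ½ * (∑ (λ y → P y * (1ℚ + - 2ℚ * ⟦ not (test y) ⟧)) + ∑ (λ y → ber y * (1ℚ + - 2ℚ * ⟦ test y ⟧)))
    ≡⟨ cong (½ *_) (sym (∑-+ _ _)) ⟩
  ½ * ∑ (λ y → P y * (1ℚ + - 2ℚ * ⟦ not (test y) ⟧) + ber y * (1ℚ + - 2ℚ * ⟦ test y ⟧))
    ≤⟨ *-monoˡ ½ 0≤½ (∑-mono pointwise) ⟩
  ½ * ∑ (λ y → ∣ P y - ber y ∣)
    ≡⟨ cong (½ *_) (∑-def (λ y → ∣ P y - ber y ∣)) ⟩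
  TV (outputDistribution Q) (Ber (+ 1 / 3) ^⊗ n) ∎
  where
  open Distinguisher dist
  open ℚ.≤-Reasoning
  P : Vec Bool n → ℚ
  P = outputDistribution Q
  push : ∀ (g : Vec Bool n → ℚ) → ∑ (λ y → P y * g y) ≡ ½ ^ m * ∑ (λ x → g (outputs (tabulate Q) x))
  push g = trans (∑-pushforward (λ x → tabulate (λ i → Q i x)) (½ ^ m) g)
    (cong (½ ^ m *_) (∑-cong (λ x → cong g (Vec.tabulate-∘ (λ f → f x) Q))))
  P-total : ∑ (λ y → P y * 1ℚ) ≡ 1ℚ
  P-total = trans (push (λ _ → 1ℚ)) (½^-*-∣𝔽₂^∣ m)
  miss′ : ∑ (λ y → P y * ⟦ not (test y) ⟧) ≤ℚ ε
  miss′ = ℚ.≤-trans (ℚ.≤-reflexive (push (λ y → ⟦ not (test y) ⟧))) (ℚ.≤-trans (*-monoˡ (½ ^ m) (0≤^ 0≤½ m) miss)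
    (ℚ.≤-reflexive (trans (solve 3 (λ h e N → h :* (e :* N) := e :* (h :* N)) refl (½ ^ m) ε ∣𝔽₂^ m ∣)
      (trans (cong (ε *_) (½^-*-∣𝔽₂^∣ m)) (ℚ.*-identityʳ ε)))))
  split : ∀ (D g : Vec Bool n → ℚ) → ∑ (λ y → D y * 1ℚ) ≡ 1ℚ →
          ∑ (λ y → D y * (1ℚ + - 2ℚ * g y)) ≡ 1ℚ + - 2ℚ * ∑ (λ y → D y * g y)
  split D g total = trans (∑-cong (λ y → term (D y) (g y)))
    (trans (∑-+ _ _) (cong₂ _+_ total (∑-*ˡ (- 2ℚ) (λ y → D y * g y))))
    where
    term : ∀ d g → d * (1ℚ + - 2ℚ * g) ≡ d * 1ℚ + - 2ℚ * (d * g)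
    term = solve 2 (λ d g → d :* (con 1ℚ :+ con (- 2ℚ) :* g) := d :* con 1ℚ :+ con (- 2ℚ) :* (d :* g)) refl
  pointwise : ∀ y → P y * (1ℚ + - 2ℚ * ⟦ not (test y) ⟧) + ber y * (1ℚ + - 2ℚ * ⟦ test y ⟧) ≤ℚ ∣ P y - ber y ∣
  pointwise y with test y
  ... | true = ℚ.≤-trans (ℚ.≤-reflexive (plus (P y) (ber y))) (p≤∣p∣ (P y - ber y))
    where
    plus : ∀ p b → p * (1ℚ + - 2ℚ * 0ℚ) + b * (1ℚ + - 2ℚ * 1ℚ) ≡ p - b
    plus = solve 2 (λ p b → p :* con (1ℚ + - 2ℚ * 0ℚ) :+ b :* con (1ℚ + - 2ℚ * 1ℚ) := p :- b) refl
  ... | false = ℚ.≤-trans (ℚ.≤-reflexive (minus (P y) (ber y))) (-p≤∣p∣ (P y - ber y))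
    where
    minus : ∀ p b → p * (1ℚ + - 2ℚ * 1ℚ) + b * (1ℚ + - 2ℚ * 0ℚ) ≡ - (p - b)
    minus = solve 2 (λ p b → p :* con (1ℚ + - 2ℚ * 1ℚ) :+ b :* con (1ℚ + - 2ℚ * 0ℚ) := :- (p :- b)) refl

-- Choice of the parameters

square≤ : ∀ {p} θ → 0ℚ ≤ℚ p → p ≤ℚ 1ℚ - θ → 0ℚ ≤ℚ θ → θ ≤ℚ ½ → p * p ≤ℚ 1ℚ - + 3 / 2 * θ
square≤ {p} θ 0≤p p≤ 0≤θ θ≤½ = ℚ.≤-trans (*-mono 0≤p (ℚ.≤-trans 0≤p p≤) p≤ p≤)
  (≤-by (θ * (½ - θ)) (0≤-* 0≤θ (0≤q-p θ≤½))
    (solve 1 (λ t → (con 1ℚ :- t) :* (con 1ℚ :- t) :+ t :* (con ½ :- t) := con 1ℚ :- con (+ 3 / 2) :* t) refl θ))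

square-power : ∀ p → ∃[ K ] (p * p) ^ suc K ≤ℚ ½ → ∃[ K ] p ^ suc K ≤ℚ ½
square-power p (K , le) = K ℕ.+ suc K , subst (_≤ℚ ½) powers le
  where
  powers : (p * p) ^ suc K ≡ p ^ (suc K ℕ.+ suc K)
  powers = trans (^-distrib-* p p (suc K)) (sym (^-homo-* p (suc K) (suc K)))

-- Every squaring of p multiplies θ by 3/2.
power≤½ : ∀ k {p} θ → 0ℚ ≤ℚ p → p ≤ℚ 1ℚ - θ → 0ℚ ≤ℚ θ → ½ ≤ℚ (+ 3 / 2) ^ k * θ → ∃[ K ] p ^ suc K ≤ℚ ½
power≤½ k {p} θ 0≤p p≤ 0≤θ ½≤ with ℚ.≤-total ½ θ
power≤½ k {p} θ 0≤p p≤ 0≤θ ½≤ | inj₁ ½≤θ = zero , ℚ.≤-trans (ℚ.≤-reflexive (ℚ.*-identityʳ p))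
  (ℚ.≤-trans p≤ (ℚ.+-monoʳ-≤ 1ℚ (ℚ.neg-antimono-≤ ½≤θ)))
power≤½ zero {p} θ 0≤p p≤ 0≤θ ½≤ | inj₂ _ = zero , ℚ.≤-trans (ℚ.≤-reflexive (ℚ.*-identityʳ p))
  (ℚ.≤-trans p≤ (ℚ.+-monoʳ-≤ 1ℚ (ℚ.neg-antimono-≤ (ℚ.≤-trans ½≤ (ℚ.≤-reflexive (ℚ.*-identityˡ θ))))))
power≤½ (suc k) {p} θ 0≤p p≤ 0≤θ ½≤ | inj₂ θ≤½ = square-power p
  (power≤½ k (+ 3 / 2 * θ) (0≤-* 0≤p 0≤p) (square≤ θ 0≤p p≤ 0≤θ θ≤½) (0≤-* {+ 3 / 2} (ℚ.≤ᵇ⇒≤ _) 0≤θ)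
    (subst (½ ≤ℚ_) (solve 3 (λ c a t → c :* a :* t := a :* (c :* t)) refl (+ 3 / 2) ((+ 3 / 2) ^ k) θ) ½≤))

opaque
  -- Thirty squarings suffice, since (3/2)^30 / 50000 ≥ 1/2; replacing (3/2)^5 by 15/2 keeps the
  -- numbers small. Opaque, so that the large K is never unfolded.
  β-halving : ∃[ K ] β ^ suc K ≤ℚ ½
  β-halving = power≤½ (5 ℕ.* 6) (+ 1 / 50000) 0≤β β≤1-η (ℚ.≤ᵇ⇒≤ _) (begin
    ½                              ≤⟨ ℚ.≤ᵇ⇒≤ _ ⟩
    (+ 15 / 2) ^ 6 * (+ 1 / 50000)   ≤⟨ *-monoʳ (+ 1 / 50000) (ℚ.≤ᵇ⇒≤ _) (^-mono (ℚ.≤ᵇ⇒≤ _) step 6) ⟩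
    ((+ 3 / 2) ^ 5) ^ 6 * (+ 1 / 50000) ≡⟨ cong (_* (+ 1 / 50000)) (^-assocʳ (+ 3 / 2) 5 6) ⟩
    (+ 3 / 2) ^ (5 ℕ.* 6) * (+ 1 / 50000) ∎)
    where
    open ℚ.≤-Reasoning
    step : + 15 / 2 ≤ℚ (+ 3 / 2) ^ 5
    step = ℚ.≤ᵇ⇒≤ _

n≤2^n : ∀ n → n ≤ 2 ℕ.^ n
n≤2^n zero = z≤n
n≤2^n (suc n) = ℕ.≤-trans (ℕ.+-mono-≤ (ℕ.m^n>0 2 n) (n≤2^n n)) (ℕ.+-monoʳ-≤ (2 ℕ.^ n) (ℕ.≤-reflexive (sym (ℕ.+-identityʳ (2 ℕ.^ n)))))

2n≤2^n : ∀ n → 1 ≤ n → n ℕ.+ n ≤ 2 ℕ.^ n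
2n≤2^n (suc zero) _ = ℕ.≤-refl
2n≤2^n (suc (suc n)) _ = begin
  suc (suc n) ℕ.+ suc (suc n)       ≡⟨ shift n ⟩
  2 ℕ.+ (suc n ℕ.+ suc n)           ≤⟨ ℕ.+-mono-≤ (ℕ.^-monoʳ-≤ 2 (s≤s (z≤n {n}))) (2n≤2^n (suc n) (s≤s z≤n)) ⟩
  2 ℕ.^ suc n ℕ.+ 2 ℕ.^ suc n       ≡⟨ cong (2 ℕ.^ suc n ℕ.+_) (sym (ℕ.+-identityʳ (2 ℕ.^ suc n))) ⟩
  2 ℕ.^ suc (suc n) ∎
  where
  open ℕ.≤-Reasoning
  shift : ∀ n → suc (suc n) ℕ.+ suc (suc n) ≡ 2 ℕ.+ (suc n ℕ.+ suc n)
  shift = solve-∀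

2^-cancel-< : ∀ a b → 2 ℕ.^ a ℕ.< 2 ℕ.^ b → a ℕ.< b
2^-cancel-< a b lt = ℕ.≰⇒> (λ b≤a → ℕ.<⇒≱ lt (ℕ.^-monoʳ-≤ 2 b≤a))

⌊log⌋ : ∀ n → 1 ≤ n → ∃[ ℓ ] (2 ℕ.^ ℓ ≤ n × n ℕ.< 2 ℕ.^ suc ℓ)
⌊log⌋ (suc zero) _ = zero , s≤s z≤n , s≤s (s≤s z≤n)
⌊log⌋ (suc (suc n)) _ with ⌊log⌋ (suc n) (s≤s z≤n)
... | ℓ , 2^ℓ≤ , <2^ with ℕ.m≤n⇒m<n∨m≡n <2^
...   | inj₁ lt = ℓ , ℕ.m≤n⇒m≤1+n 2^ℓ≤ , lt
...   | inj₂ eq = suc ℓ , ℕ.≤-reflexive (sym eq) , subst (ℕ._< 2 ℕ.^ suc (suc ℓ)) (sym eq) (ℕ.^-monoʳ-< 2 (s≤s (s≤s z≤n)) (ℕ.n<1+n (suc ℓ)))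

module Asymptotics (K : ℕ) (βᴷ≤½ : β ^ suc K ≤ℚ ½) where
  open Petals (suc K) βᴷ≤½
  open ℕ.≤-Reasoning

  module _ (t-1 κ : ℕ) where
    private
      t = suc t-1
      M = 3 ℕ.* (suc K ℕ.* t)

    -- Measured by s + κ instead of s, a round is multiplication by at most M = O(t), with no
    -- additive term left to iterate.
    petals+s≤ : ∀ s → petals t κ s ℕ.+ s ℕ.+ κ ≤ M ℕ.* (s ℕ.+ κ)
    petals+s≤ s = begin
      suc K ℕ.* (s ℕ.* (t ℕ.+ t) ℕ.+ κ) ℕ.+ s ℕ.+ κ
        ≡⟨ ℕ.+-assoc (petals t κ s) s κ ⟩
      suc K ℕ.* (s ℕ.* (t ℕ.+ t) ℕ.+ κ) ℕ.+ (s ℕ.+ κ)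
        ≤⟨ ℕ.+-mono-≤ (ℕ.*-monoʳ-≤ (suc K) (ℕ.+-monoʳ-≤ (s ℕ.* (t ℕ.+ t)) (ℕ.m≤m*n κ (t ℕ.+ t))))
                      (ℕ.m≤n*m (s ℕ.+ κ) (suc K ℕ.* t)) ⟩
      suc K ℕ.* (s ℕ.* (t ℕ.+ t) ℕ.+ κ ℕ.* (t ℕ.+ t)) ℕ.+ suc K ℕ.* t ℕ.* (s ℕ.+ κ)
        ≡⟨ factor (suc K) t s κ ⟩
      M ℕ.* (s ℕ.+ κ) ∎
      where
      factor : ∀ a t s κ → a ℕ.* (s ℕ.* (t ℕ.+ t) ℕ.+ κ ℕ.* (t ℕ.+ t)) ℕ.+ a ℕ.* t ℕ.* (s ℕ.+ κ) ≡ 3 ℕ.* (a ℕ.* t) ℕ.* (s ℕ.+ κ)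
      factor = solve-∀

    needed≤ : ∀ r s → needed t κ r s ≤ M ℕ.^ suc r ℕ.* (s ℕ.+ κ)
    needed≤ zero s = begin
      petals t κ s                      ≤⟨ ℕ.m≤m+n _ (s ℕ.+ κ) ⟩
      petals t κ s ℕ.+ (s ℕ.+ κ)        ≡⟨ sym (ℕ.+-assoc (petals t κ s) s κ) ⟩
      petals t κ s ℕ.+ s ℕ.+ κ          ≤⟨ petals+s≤ s ⟩
      M ℕ.* (s ℕ.+ κ)                   ≡⟨ cong (ℕ._* (s ℕ.+ κ)) (sym (ℕ.*-identityʳ M)) ⟩
      M ℕ.^ 1 ℕ.* (s ℕ.+ κ)             ∎
    needed≤ (suc r) s = begin
      needed t κ r (petals t κ s ℕ.+ s)           ≤⟨ needed≤ r (petals t κ s ℕ.+ s) ⟩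
      M ℕ.^ suc r ℕ.* (petals t κ s ℕ.+ s ℕ.+ κ)  ≤⟨ ℕ.*-monoʳ-≤ (M ℕ.^ suc r) (petals+s≤ s) ⟩
      M ℕ.^ suc r ℕ.* (M ℕ.* (s ℕ.+ κ))           ≡⟨ sym (ℕ.*-assoc (M ℕ.^ suc r) M (s ℕ.+ κ)) ⟩
      M ℕ.^ suc r ℕ.* M ℕ.* (s ℕ.+ κ)             ≡⟨ cong (ℕ._* (s ℕ.+ κ)) (ℕ.*-comm (M ℕ.^ suc r) M) ⟩
      M ℕ.^ suc (suc r) ℕ.* (s ℕ.+ κ)             ∎

  -- ℓ and l stand for log n and log log n, and K here for `suc K`. From 3K² ≤ 2^e with e < l and κ
  -- + 1 ≤ ℓ < 2^(l+1) comes M ≤ 2^(2l). There are 2t + 2 ≤ 4t factors M, so the exponent is at most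
  -- 8Kl(κ + 1) ≤ ℓ.
  needed≤2^ : ∀ κ e ℓ l → 3 ℕ.* (suc K ℕ.* suc K) ≤ 2 ℕ.^ e → e ℕ.< l → ℓ ℕ.< 2 ℕ.^ suc l →
              suc κ ℕ.* (8 ℕ.* (suc K ℕ.* l)) ≤ ℓ →
              let t = suc K ℕ.* suc κ in needed t (κ ℕ.+ t) (t ℕ.+ t) 0 ≤ 2 ℕ.^ ℓ
  needed≤2^ κ e ℓ l 3K²≤ e<l ℓ< q≤ = begin
    needed t (κ ℕ.+ t) (t ℕ.+ t) 0        ≤⟨ needed≤ (κ ℕ.+ K ℕ.* suc κ) (κ ℕ.+ t) (t ℕ.+ t) 0 ⟩
    M ℕ.^ suc (t ℕ.+ t) ℕ.* (κ ℕ.+ t)     ≤⟨ ℕ.*-monoʳ-≤ (M ℕ.^ suc (t ℕ.+ t)) κ+t≤M ⟩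
    M ℕ.^ suc (t ℕ.+ t) ℕ.* M             ≡⟨ ℕ.*-comm (M ℕ.^ suc (t ℕ.+ t)) M ⟩
    M ℕ.^ suc (suc (t ℕ.+ t))             ≤⟨ ℕ.^-monoˡ-≤ (suc (suc (t ℕ.+ t))) M≤ ⟩
    (2 ℕ.^ (l ℕ.+ l)) ℕ.^ suc (suc (t ℕ.+ t)) ≡⟨ ℕ.^-*-assoc 2 (l ℕ.+ l) (suc (suc (t ℕ.+ t))) ⟩
    2 ℕ.^ ((l ℕ.+ l) ℕ.* suc (suc (t ℕ.+ t))) ≤⟨ ℕ.^-monoʳ-≤ 2 exponent≤ ⟩
    2 ℕ.^ ℓ                               ∎
    where
    t = suc K ℕ.* suc κ
    M = 3 ℕ.* (suc K ℕ.* t)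
    1≤t : 1 ≤ t
    1≤t = s≤s z≤n
    sκ≤t : suc κ ≤ t
    sκ≤t = ℕ.m≤n*m (suc κ) (suc K)
    κ+t≤M : κ ℕ.+ t ≤ M
    κ+t≤M = begin
      κ ℕ.+ t            ≤⟨ ℕ.+-monoˡ-≤ t (ℕ.≤-trans (ℕ.n≤1+n κ) sκ≤t) ⟩
      t ℕ.+ t            ≤⟨ ℕ.+-monoʳ-≤ t (ℕ.m≤m+n t (t ℕ.+ 0)) ⟩
      3 ℕ.* t            ≤⟨ ℕ.*-monoʳ-≤ 3 (ℕ.m≤n*m t (suc K)) ⟩
      M                  ∎
    sκ≤ℓ : suc κ ≤ ℓ
    sκ≤ℓ = ℕ.≤-trans (ℕ.m≤m*n (suc κ) (8 ℕ.* (suc K ℕ.* l)) {{ℕ.m*n≢0 8 (suc K ℕ.* l) {{_}} {{ℕ.m*n≢0 (suc K) l {{_}} {{ℕ.>-nonZero (ℕ.≤-<-trans z≤n e<l)}}}}}}) q≤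
    M≤ : M ≤ 2 ℕ.^ (l ℕ.+ l)
    M≤ = begin
      3 ℕ.* (suc K ℕ.* (suc K ℕ.* suc κ))   ≡⟨ regroup (suc K) (suc κ) ⟩
      3 ℕ.* (suc K ℕ.* suc K) ℕ.* suc κ     ≤⟨ ℕ.*-mono-≤ 3K²≤ (ℕ.≤-trans sκ≤ℓ (ℕ.<⇒≤ ℓ<)) ⟩
      2 ℕ.^ e ℕ.* 2 ℕ.^ suc l               ≡⟨ sym (ℕ.^-distribˡ-+-* 2 e (suc l)) ⟩
      2 ℕ.^ (e ℕ.+ suc l)                   ≡⟨ cong (2 ℕ.^_) (ℕ.+-suc e l) ⟩
      2 ℕ.^ (suc e ℕ.+ l)                   ≤⟨ ℕ.^-monoʳ-≤ 2 (ℕ.+-monoˡ-≤ l e<l) ⟩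
      2 ℕ.^ (l ℕ.+ l)                       ∎
      where
      regroup : ∀ a q → 3 ℕ.* (a ℕ.* (a ℕ.* q)) ≡ 3 ℕ.* (a ℕ.* a) ℕ.* q
      regroup = solve-∀
    exponent≤ : (l ℕ.+ l) ℕ.* suc (suc (t ℕ.+ t)) ≤ ℓ
    exponent≤ = begin
      (l ℕ.+ l) ℕ.* (2 ℕ.+ (t ℕ.+ t))       ≤⟨ ℕ.*-monoʳ-≤ (l ℕ.+ l) (ℕ.+-monoˡ-≤ (t ℕ.+ t) (ℕ.+-mono-≤ 1≤t 1≤t)) ⟩
      (l ℕ.+ l) ℕ.* (t ℕ.+ t ℕ.+ (t ℕ.+ t)) ≡⟨ regroup l (suc K) (suc κ) ⟩
      suc κ ℕ.* (8 ℕ.* (suc K ℕ.* l))       ≤⟨ q≤ ⟩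
      ℓ                                     ∎
      where
      regroup : ∀ l a q → (l ℕ.+ l) ℕ.* (a ℕ.* q ℕ.+ a ℕ.* q ℕ.+ (a ℕ.* q ℕ.+ a ℕ.* q)) ≡ q ℕ.* (8 ℕ.* (a ℕ.* l))
      regroup = solve-∀

  -- The bound on ℓ + 1 makes 2^-κ at most n^(-1/(Cl)). The combinatorial part is run with `suc κ`,
  -- because the passage to the distance doubles the error.
  Parameters : ℕ → ℕ → Set
  Parameters C n = ∃[ ℓ ] ∃[ l ] ∃[ κ ]
    (2 ℕ.^ ℓ ≤ n × n ≤ 2 ℕ.^ suc ℓ × 2 ℕ.^ l ≤ ℓ × suc ℓ ≤ κ ℕ.* (l ℕ.* C) ×
     (let t = suc K ℕ.* suc (suc κ) in needed t (suc κ ℕ.+ t) (t ℕ.+ t) 0 ≤ n))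

  module _ {C e d l₀} (C≡ : C ≡ 32 ℕ.* suc K) (3K²≤ : 3 ℕ.* (suc K ℕ.* suc K) ≤ 2 ℕ.^ e) (24K≤ : 24 ℕ.* suc K ≤ 2 ℕ.^ d)
           (1≤d : 1 ≤ d) (≤l₀ : suc (e ℕ.+ (d ℕ.+ d)) ≤ l₀) where

    parameters : ∀ n → 2 ℕ.^ (2 ℕ.^ l₀) ≤ n → Parameters C n
    parameters n n₀≤n with ⌊log⌋ n (ℕ.≤-trans (ℕ.m^n>0 2 (2 ℕ.^ l₀)) n₀≤n)
    ... | ℓ , 2^ℓ≤n , n<2^ with ⌊log⌋ ℓ (ℕ.≤-trans (ℕ.m^n>0 2 l₀) 2^l₀≤ℓ)
      where
      2^l₀≤ℓ : 2 ℕ.^ l₀ ≤ ℓ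
      2^l₀≤ℓ = ℕ.≤-pred (2^-cancel-< (2 ℕ.^ l₀) (suc ℓ) (ℕ.≤-<-trans n₀≤n n<2^))
    ...   | l , 2^l≤ℓ , ℓ<2^ = ℓ , l , κ , 2^ℓ≤n , ℕ.<⇒≤ n<2^ , 2^l≤ℓ , sℓ≤ ,
              ℕ.≤-trans (needed≤2^ (suc κ) e ℓ l 3K²≤ e<l ℓ<2^ q≤) 2^ℓ≤n
      where
      l₀≤l : l₀ ≤ l
      l₀≤l = ℕ.≤-pred (2^-cancel-< l₀ (suc l) (ℕ.≤-<-trans
        (ℕ.≤-pred (2^-cancel-< (2 ℕ.^ l₀) (suc ℓ) (ℕ.≤-<-trans n₀≤n n<2^))) ℓ<2^))
      e<l : e ℕ.< l
      e<l = ℕ.≤-trans (s≤s (ℕ.m≤m+n e (d ℕ.+ d))) (ℕ.≤-trans ≤l₀ l₀≤l)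
      2d≤l : d ℕ.+ d ≤ l
      2d≤l = ℕ.≤-trans (ℕ.≤-trans (ℕ.m≤n+m (d ℕ.+ d) e) (ℕ.n≤1+n _)) (ℕ.≤-trans ≤l₀ l₀≤l)
      x = l ℕ.∸ d
      d≤x : d ≤ x
      d≤x = subst (_≤ x) (ℕ.m+n∸n≡m d d) (ℕ.∸-monoˡ-≤ d 2d≤l)
      x+d≡l : x ℕ.+ d ≡ l
      x+d≡l = ℕ.m∸n+n≡m (ℕ.≤-trans (ℕ.m≤m+n d d) 2d≤l)
      -- With l = x + d and d ≤ x, the factor l is at most 2x ≤ 2^x, and 2^d pays for the constant.
      24Kl≤ℓ : 24 ℕ.* suc K ℕ.* l ≤ ℓ
      24Kl≤ℓ = begin
        24 ℕ.* suc K ℕ.* l          ≡⟨ cong (24 ℕ.* suc K ℕ.*_) (sym x+d≡l) ⟩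
        24 ℕ.* suc K ℕ.* (x ℕ.+ d)  ≤⟨ ℕ.*-mono-≤ 24K≤ (ℕ.≤-trans (ℕ.+-monoʳ-≤ x d≤x) (2n≤2^n x (ℕ.≤-trans 1≤d d≤x))) ⟩
        2 ℕ.^ d ℕ.* 2 ℕ.^ x         ≡⟨ sym (ℕ.^-distribˡ-+-* 2 d x) ⟩
        2 ℕ.^ (d ℕ.+ x)             ≡⟨ cong (2 ℕ.^_) (trans (ℕ.+-comm d x) x+d≡l) ⟩
        2 ℕ.^ l                     ≤⟨ 2^l≤ℓ ⟩
        ℓ                           ∎
      width = 8 ℕ.* (suc K ℕ.* l)
      instance
        width≢0 : NonZero width
        width≢0 = ℕ.m*n≢0 8 (suc K ℕ.* l) {{_}} {{ℕ.m*n≢0 (suc K) l {{_}} {{ℕ.>-nonZero (ℕ.≤-<-trans z≤n e<l)}}}}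
      -- The largest admissible value of κ + 2, the factor that `needed≤2^` receives when applied to
      -- `suc κ`.
      q = ℓ ℕ./ width
      κ = q ℕ.∸ 2
      3≤q : 3 ≤ q
      3≤q = subst (_≤ q) (ℕ.m*n/n≡m 3 width) (ℕ./-monoˡ-≤ width (ℕ.≤-trans (ℕ.≤-reflexive (regroup (suc K) l)) 24Kl≤ℓ))
        where
        regroup : ∀ a l → 3 ℕ.* (8 ℕ.* (a ℕ.* l)) ≡ 24 ℕ.* a ℕ.* l
        regroup = solve-∀
      κ+2≡q : suc (suc κ) ≡ q
      κ+2≡q = trans (ℕ.+-comm 2 κ) (ℕ.m∸n+n≡m (ℕ.≤-trans (ℕ.n≤1+n 2) 3≤q))
      q≤ : suc (suc κ) ℕ.* width ≤ ℓ
      q≤ = subst (λ j → j ℕ.* width ≤ ℓ) (sym κ+2≡q) (ℕ.m/n*n≤m ℓ width)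
      1≤κ : 1 ≤ κ
      1≤κ = ℕ.∸-monoˡ-≤ 2 3≤q
      -- ℓ + 1 is at most q + 1 = κ + 3 widths, and κ ≥ 1 gives κ + 3 ≤ 4κ. This is where C becomes
      -- 4 · 8 = 32 times `suc K`.
      sℓ≤ : suc ℓ ≤ κ ℕ.* (l ℕ.* C)
      sℓ≤ = begin
        suc ℓ                              ≡⟨ cong suc (ℕ.m≡m%n+[m/n]*n ℓ width) ⟩
        suc (ℓ ℕ.% width) ℕ.+ q ℕ.* width          ≤⟨ ℕ.+-monoˡ-≤ (q ℕ.* width) (ℕ.m%n<n ℓ width) ⟩
        width ℕ.+ q ℕ.* width                      ≡⟨ cong (λ j → suc j ℕ.* width) (sym κ+2≡q) ⟩
        (3 ℕ.+ κ) ℕ.* width                    ≤⟨ ℕ.*-monoˡ-≤ width (ℕ.+-monoˡ-≤ κ (ℕ.*-monoʳ-≤ 3 1≤κ)) ⟩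
        (3 ℕ.* κ ℕ.+ κ) ℕ.* width              ≡⟨ regroup κ (suc K) l ⟩
        κ ℕ.* (l ℕ.* (32 ℕ.* suc K))       ≡⟨ cong (λ c → κ ℕ.* (l ℕ.* c)) (sym C≡) ⟩
        κ ℕ.* (l ℕ.* C)                    ∎
        where
        regroup : ∀ κ a l → (3 ℕ.* κ ℕ.+ κ) ℕ.* (8 ℕ.* (a ℕ.* l)) ≡ κ ℕ.* (l ℕ.* (32 ℕ.* a))
        regroup = solve-∀

-- The real bound

ι : ℕ → ℚ
ι n = + n / 1

ι≃ : ∀ n → toℚᵘ (ι n) ℚᵘ.≃ mkℚᵘ (+ n) 0
ι≃ n = ℚ.toℚᵘ-fromℚᵘ (mkℚᵘ (+ n) 0)

ι-mono-≤ : ∀ {a b} → a ≤ b → ι a ≤ℚ ι b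
ι-mono-≤ {a} {b} a≤b = ℚ.toℚᵘ-cancel-≤ (ℚᵘ.≤-respˡ-≃ (ℚᵘ.≃-sym (ι≃ a)) (ℚᵘ.≤-respʳ-≃ (ℚᵘ.≃-sym (ι≃ b))
  (*≤* (subst₂ ℤ._≤_ (sym (ℤ.*-identityʳ (+ a))) (sym (ℤ.*-identityʳ (+ b))) (ℤ.+≤+ a≤b)))))

≤-<-irrefl : ∀ {p q} {A : Set} → p ≤ℚ q → q < p → A
≤-<-irrefl p≤q q<p = contradiction (ℚ.≤-<-trans p≤q q<p) (ℚ.<-irrefl refl)

ι-cancel-< : ∀ {a b} → ι a < ι b → a ℕ.< b
ι-cancel-< {a} {b} ιa<ιb = ℕ.≰⇒> (λ b≤a → ≤-<-irrefl (ι-mono-≤ b≤a) ιa<ιb)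

ι-* : ∀ a b → ι (a ℕ.* b) ≡ ι a * ι b
ι-* a b = ℚ.toℚᵘ-injective (ℚᵘ.≃-trans (ι≃ (a ℕ.* b)) (ℚᵘ.≃-trans (*≡* (cong (ℤ._* + 1) (ℤ.pos-* a b)))
  (ℚᵘ.≃-sym (ℚᵘ.≃-trans (ℚ.toℚᵘ-homo-* (ι a) (ι b)) (ℚᵘ.*-cong (ι≃ a) (ι≃ b))))))

ι-^ : ∀ a k → ι (a ℕ.^ k) ≡ ι a ^ k
ι-^ a zero = refl
ι-^ a (suc k) = trans (ι-* a (a ℕ.^ k)) (cong (ι a *_) (ι-^ a k))

1/-*-ι : ∀ N .{{_ : NonZero N}} → (+ 1 / N) * ι N ≡ 1ℚ
1/-*-ι (suc N) = ℚ.toℚᵘ-injective (ℚᵘ.≃-trans (ℚ.toℚᵘ-homo-* (+ 1 / suc N) (ι (suc N)))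
  (ℚᵘ.≃-trans (ℚᵘ.*-cong (ℚ.toℚᵘ-fromℚᵘ (mkℚᵘ (+ 1) N)) (ι≃ (suc N)))
    (*≡* (trans (ℤ.*-identityʳ (+ 1 ℤ.* + suc N)) (cong (+ 1 ℤ.*_) (cong +_ (sym (ℕ.*-identityʳ (suc N)))))))))

0<1/ : ∀ N .{{_ : NonZero N}} → 0ℚ < + 1 / N
0<1/ N = ℚ.positive⁻¹ (+ 1 / N) {{ℚ.normalize-pos 1 N}}

0<ι : ∀ N .{{_ : NonZero N}} → 0ℚ < ι N
0<ι N = ℚ.positive⁻¹ (ι N) {{ℚ.normalize-pos N 1}}

1≤ι : ∀ N .{{_ : NonZero N}} → 1ℚ ≤ℚ ι N
1≤ι N = ι-mono-≤ (ℕ.>-nonZero⁻¹ N)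

1/≤1 : ∀ N .{{_ : NonZero N}} → + 1 / N ≤ℚ 1ℚ
1/≤1 N = subst₂ _≤ℚ_ (ℚ.*-identityʳ (+ 1 / N)) (1/-*-ι N) (*-monoˡ (+ 1 / N) (ℚ.<⇒≤ (0<1/ N)) (1≤ι N))

-- For b = k/d the cut r < 2^b unfolds to r^d < 2^k, whence 2^(ad) < 2^k; a negative numerator would
-- force r < 1. Two applications bound log log n from below by an integer.
<2^⇒log< : ∀ a N r b → 2 ℕ.^ a ≤ N → ι N < r → r < 2 ^ℚ b → ι a < b
<2^⇒log< a N r b 2^a≤N N<r (inj₁ r≤0) = ≤-<-irrefl (ℚ.≤-trans r≤0 (ι-mono-≤ (z≤n {N}))) N<r
<2^⇒log< a N r (mkℚ (+ k) d-1 cop) 2^a≤N N<r (inj₂ r^d<2^k) =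
  ℚ.toℚᵘ-cancel-< (ℚᵘ.<-respˡ-≃ (ℚᵘ.≃-sym (ι≃ a)) (*<*
    (subst₂ ℤ._<_ (ℤ.pos-* a (suc d-1)) (sym (ℤ.*-identityʳ (+ k))) (ℤ.+<+ ad<k))))
  where
  ad<k : a ℕ.* suc d-1 ℕ.< k
  ad<k = 2^-cancel-< (a ℕ.* suc d-1) k (ι-cancel-< (ℚ.≤-<-trans (begin
    ι (2 ℕ.^ (a ℕ.* suc d-1))   ≡⟨ cong ι (sym (ℕ.^-*-assoc 2 a (suc d-1))) ⟩
    ι ((2 ℕ.^ a) ℕ.^ suc d-1)   ≡⟨ ι-^ (2 ℕ.^ a) (suc d-1) ⟩
    ι (2 ℕ.^ a) ^ suc d-1       ≤⟨ ^-mono (ι-mono-≤ (z≤n {2 ℕ.^ a})) (ℚ.≤-trans (ι-mono-≤ 2^a≤N) (ℚ.<⇒≤ N<r)) (suc d-1) ⟩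
    r ^ suc d-1                 ∎) r^d<2^k))
    where open ℚ.≤-Reasoning
<2^⇒log< a N r (mkℚ -[1+ k ] d-1 cop) 2^a≤N N<r (inj₂ r^d<2^k) = ≤-<-irrefl
  (ℚ.≤-trans (1/≤1 (2 ℕ.^ suc k) {{ℕ.m^n≢0 2 (suc k)}}) (subst (_≤ℚ r ^ suc d-1) (1^ (suc d-1)) (^-mono 0≤1 1≤r (suc d-1)))) r^d<2^k
  where
  1≤r : 1ℚ ≤ℚ r
  1≤r = ℚ.≤-trans (ι-mono-≤ (ℕ.≤-trans (ℕ.m^n>0 2 a) 2^a≤N)) (ℚ.<⇒≤ N<r)
  1^ : ∀ n → 1ℚ ^ n ≡ 1ℚ
  1^ zero = refl
  1^ (suc n) = trans (ℚ.*-identityˡ (1ℚ ^ n)) (1^ n)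

numerator*<denominator : ∀ p {u} N → ↥ p ≡ + u → p * ι N < 1ℚ → u ℕ.* N ℕ.< ↧ₙ p
numerator*<denominator p@(mkℚ _ d-1 _) {u} N refl lt
  with ℚᵘ.<-respˡ-≃ (ℚᵘ.≃-trans (ℚ.toℚᵘ-homo-* p (ι N)) (ℚᵘ.*-congˡ {mkℚᵘ (+ u) d-1} (ι≃ N))) (ℚ.toℚᵘ-mono-< lt)
... | *<* uN<d = ℤ.drop‿+<+ (subst₂ ℤ._<_ (trans (ℤ.*-identityʳ (+ u ℤ.* + N)) (sym (ℤ.pos-* u N)))
        (trans (ℤ.*-identityˡ _) (cong +_ (ℕ.*-identityʳ (suc d-1)))) uN<d)

½^*ι2^ : ∀ t → ½ ^ t * ι (2 ℕ.^ t) ≡ 1ℚ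
½^*ι2^ t = trans (cong (λ p → ½ ^ t * p) (ι-^ 2 t)) (½^*2^ t)

module _ (n : ℕ) .{{_ : NonZero n}} {ℓ l κ C : ℕ} .{{_ : NonZero C}}
         (2^ℓ≤n : 2 ℕ.^ ℓ ≤ n) (n≤2^ : n ≤ 2 ℕ.^ suc ℓ) (2^l≤ℓ : 2 ℕ.^ l ≤ ℓ) (ℓ< : suc ℓ ≤ κ ℕ.* (l ℕ.* C)) where

  -- If -r = u/d with u > 0, then u l C < d, so (ℓ + 1)u ≤ κ l C u ≤ κ d and 2^(-κd) ≤ 2^(-(ℓ+1)u) ≤
  -- n^-u. Hence y < 2^-κ contradicts n^-u < y^d. For r ≥ 0 already n^r ≥ 1.
  ½^κ≤n^ : ∀ r b y → ι l < b → - r * b < + 1 / C → 0ℚ < y → n ^ᶻ (↥ r) < y ^ (↧ₙ r) → ½ ^ κ ≤ℚ y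
  ½^κ≤n^ r b y l<b rb<c 0<y n^r<y = ℚ.≮⇒≥ (λ y<½^κ → absurd r rb<c n^r<y (λ d →
      ℚ.≤-trans (^-mono (ℚ.<⇒≤ 0<y) (ℚ.<⇒≤ y<½^κ) d) (ℚ.≤-reflexive (^-assocʳ ½ κ d))))
    where
    absurd : ∀ {A : Set} r → - r * b < + 1 / C → n ^ᶻ (↥ r) < y ^ (↧ₙ r) → (∀ d → y ^ d ≤ℚ ½ ^ (κ ℕ.* d)) → A
    absurd (mkℚ (+ k) d-1 _) _ n^r<y y^≤ = ≤-<-irrefl
      (ℚ.≤-trans (y^≤ (suc d-1)) (ℚ.≤-trans (½^-mono {zero} {κ ℕ.* suc d-1} z≤n) (1≤ι (n ℕ.^ k) {{ℕ.m^n≢0 n k}}))) n^r<y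
    absurd (mkℚ -[1+ k ] d-1 cop) rb<c n^r<y y^≤ = ≤-<-irrefl (begin
      y ^ suc d-1                 ≤⟨ y^≤ (suc d-1) ⟩
      ½ ^ (κ ℕ.* suc d-1)         ≤⟨ ½^-mono exponent≤ ⟩
      ½ ^ (suc ℓ ℕ.* suc k)       ≤⟨ *-cancelʳ (ι (n ℕ.^ suc k)) (0<ι (n ℕ.^ suc k)) ½^≤1/n^ ⟩
      + 1 / (n ℕ.^ suc k)         ∎) n^r<y
      where
      open ℚ.≤-Reasoning
      instance
        n^≢0 : NonZero (n ℕ.^ suc k)
        n^≢0 = ℕ.m^n≢0 n (suc k)
      p = mkℚ (+ suc k) d-1 cop
      ½^≤1/n^ : ½ ^ (suc ℓ ℕ.* suc k) * ι (n ℕ.^ suc k) ≤ℚ (+ 1 / (n ℕ.^ suc k)) * ι (n ℕ.^ suc k)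
      ½^≤1/n^ = begin
        ½ ^ (suc ℓ ℕ.* suc k) * ι (n ℕ.^ suc k)
          ≤⟨ *-monoˡ (½ ^ (suc ℓ ℕ.* suc k)) (0≤^ 0≤½ (suc ℓ ℕ.* suc k)) (ι-mono-≤ (ℕ.≤-trans (ℕ.^-monoˡ-≤ (suc k) n≤2^) (ℕ.≤-reflexive (ℕ.^-*-assoc 2 (suc ℓ) (suc k))))) ⟩
        ½ ^ (suc ℓ ℕ.* suc k) * ι (2 ℕ.^ (suc ℓ ℕ.* suc k))
          ≡⟨ ½^*ι2^ (suc ℓ ℕ.* suc k) ⟩
        1ℚ
          ≡⟨ sym (1/-*-ι (n ℕ.^ suc k)) ⟩
        (+ 1 / (n ℕ.^ suc k)) * ι (n ℕ.^ suc k) ∎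
      plC<1 : p * ι (l ℕ.* C) < 1ℚ
      plC<1 = begin-strict
        p * ι (l ℕ.* C)      ≡⟨ trans (cong (p *_) (ι-* l C)) (sym (ℚ.*-assoc p (ι l) (ι C))) ⟩
        p * ι l * ι C        ≤⟨ *-monoʳ (ι C) (ℚ.<⇒≤ (0<ι C)) (*-monoˡ p (ℚ.<⇒≤ (ℚ.positive⁻¹ p)) (ℚ.<⇒≤ l<b)) ⟩
        p * b * ι C          <⟨ ℚ.*-monoˡ-<-pos (ι C) {{positive (0<ι C)}} rb<c ⟩
        (+ 1 / C) * ι C      ≡⟨ 1/-*-ι C ⟩
        1ℚ                   ∎
      exponent≤ : suc ℓ ℕ.* suc k ≤ κ ℕ.* suc d-1
      exponent≤ = ℕ.≤-trans (ℕ.*-monoˡ-≤ (suc k) ℓ<) (ℕ.≤-trans (ℕ.≤-reflexive (regroup κ (l ℕ.* C) (suc k)))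
        (ℕ.*-monoʳ-≤ κ (ℕ.<⇒≤ (numerator*<denominator p (l ℕ.* C) refl plC<1))))
        where
        regroup : ∀ a b c → a ℕ.* b ℕ.* c ≡ a ℕ.* (c ℕ.* b)
        regroup = solve-∀

  1-n^≤ᴿ : ∀ {p} → 1ℚ - ½ ^ κ ≤ℚ p →
           fromℚ 1ℚ -ᴿ n ^ᴿ (-ᴿ (fromℚ (+ 1 / C) ÷ᴿ log (log (fromℕ n)))) ≤ᴿ fromℚ p
  -- The unpacked cuts: b₁ is above log log n, a₁ below 1/C and -r b₁ < a₁, so r is above the
  -- exponent, and -b is above n^r.
  1-n^≤ᴿ {p} ≤p q (a , b , a<1 , (r , (a₁ , b₁ , a₁<c , (r₂ , (r₁ , n<r₁ , r₁<2^r₂) , r₂<2^b₁) , 0<b₁ , rb<a₁) , (0<-b , n^r<-b)) , refl) =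
    ℚ.<-≤-trans (ℚ.+-mono-<-≤ a<1 b≤) ≤p
    where
    l<b₁ : ι l < b₁
    l<b₁ = <2^⇒log< l ℓ r₂ b₁ 2^l≤ℓ (<2^⇒log< ℓ n r₁ r₂ 2^ℓ≤n n<r₁ r₁<2^r₂) r₂<2^b₁
    b≤ : b ≤ℚ - (½ ^ κ)
    b≤ = subst (_≤ℚ - (½ ^ κ)) (solve 1 (λ b → :- :- b := b) refl b)
      (ℚ.neg-antimono-≤ (½^κ≤n^ r b₁ (- b) l<b₁ (ℚ.<-trans rb<a₁ a₁<c) 0<-b n^r<-b))

module _ {K : ℕ} (β^≤½ : β ^ suc K ≤ℚ ½) {C e d l₀ : ℕ} .{{_ : NonZero C}} (C≡ : C ≡ 32 ℕ.* suc K)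
         (3K²≤ : 3 ℕ.* (suc K ℕ.* suc K) ≤ 2 ℕ.^ e) (24K≤ : 24 ℕ.* suc K ≤ 2 ℕ.^ d)
         (1≤d : 1 ≤ d) (≤l₀ : suc (e ℕ.+ (d ℕ.+ d)) ≤ l₀) where
  open Asymptotics K β^≤½

  TV-quadratic-Ber : ∀ (n : ℕ) .{{_ : NonZero n}} → 2 ℕ.^ (2 ℕ.^ l₀) ≤ n →
    ∀ (m : ℕ) (Q : Fin n → Vec 𝔽₂ m → 𝔽₂) → (∀ i → IsPolynomialOfDegree≤ 2 (Q i)) →
    fromℚ 1ℚ -ᴿ n ^ᴿ (-ᴿ (fromℚ (+ 1 / C) ÷ᴿ log (log (fromℕ n))))
    ≤ᴿ fromℚ (TV (outputDistribution Q) (Ber (+ 1 / 3) ^⊗ n))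
  TV-quadratic-Ber n n₀≤n m Q quadratic = conclude (parameters {e = e} {d} C≡ 3K²≤ 24K≤ 1≤d ≤l₀ n n₀≤n)
    where
    conclude : Parameters C n → fromℚ 1ℚ -ᴿ n ^ᴿ (-ᴿ (fromℚ (+ 1 / C) ÷ᴿ log (log (fromℕ n))))
               ≤ᴿ fromℚ (TV (outputDistribution Q) (Ber (+ 1 / 3) ^⊗ n))
    conclude (ℓ , l , κ , 2^ℓ≤n , n≤2^ , 2^l≤ℓ , ℓ< , enough) = 1-n^≤ᴿ n {ℓ} {l} {κ} 2^ℓ≤n n≤2^ 2^l≤ℓ ℓ<
      (ℚ.≤-trans (ℚ.≤-reflexive (cong (λ ε → 1ℚ - ε) (solve 1 (λ h → h := con 2ℚ :* (con ½ :* h)) refl (½ ^ κ))))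
                 (TV-distinguisher Q distinguisher))
      where
      distinguisher : Distinguisher (tabulate Q) (½ ^ suc κ)
      distinguisher = Combinatorial.quadratic-distinguisher (suc K) β^≤½ (suc κ) (tabulate Q)
        (All.tabulate⁺ (λ i → Degree<-polynomial (quadratic i))) enough

theorem9p1 : ∃[ c ] (0ℚ < c × ∃[ n₀ ] (∀ (n : ℕ) .{{_ : NonZero n}} → n₀ ≤ n →
    ∀ (m : ℕ) (Q : Fin n → Vec 𝔽₂ m → 𝔽₂) →
    (∀ i → IsPolynomialOfDegree≤ 2 (Q i)) →
    fromℚ 1ℚ -ᴿ n ^ᴿ (-ᴿ (fromℚ c ÷ᴿ log (log (fromℕ n))))
    ≤ᴿ fromℚ (TV (outputDistribution Q) (Ber (+ 1 / 3) ^⊗ n))))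
theorem9p1 = let K , β^≤½ = β-halving
                 -- `e` and `d` are the crude choices for which x ≤ 2^x supplies the two required
                 -- bounds by powers of two.
                 C = 32 ℕ.* suc K
                 e = 3 ℕ.* (suc K ℕ.* suc K)
                 d = 24 ℕ.* suc K
                 l₀ = suc (e ℕ.+ (d ℕ.+ d))
  in + 1 / C , 0<1/ C , 2 ℕ.^ (2 ℕ.^ l₀) ,
     TV-quadratic-Ber β^≤½ {C} {e} {d} {l₀} refl (n≤2^n e) (n≤2^n d) (s≤s z≤n) ℕ.≤-refl
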